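{- There exists a parallel algorithm that can solve the unlimited knapsack problem in $O(nW)$ work and $O(\mathrm{rank}(W)\log n)$ span, where $n$ is the number of items, $W$ is the weight limit, $\mathrm{rank}(W)=W/w^*$, and $w^*$ is the minimum weight of the items.
   Context: Unlimited knapsack problem: given a weight limit $W$ and a set of $n$ items, item $i$ having an integer weight $w_i$ and a value $v_i$, select some items (each may be selected multiple times) of total weight within $W$ so as to maximize their total value. With $dp[j]$ denoting the maximum value achievable with weight limit $j$, the recurrence is $dp[j]=\max\{0,\max_{i:\,w_i\le j}(dp[j-w_i]+v_i)\}$ for $j=0,1,\dots,W$. Here $w^*=\min_i w_i$. Model: work-span binary-forking model. Threads share memory and run standard RAM instructions and a fork instruction that creates two child threads (the parent is suspended until both terminate), together with the atomic operation test-and-set. Work is the total number of instructions; span is the length of the longest sequence of dependent instructions. -}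

module Defs where

open import Data.Bool using (if_then_else_)
open import Data.Fin using (Fin; zero; suc)
open import Data.Integer as ℤ using (ℤ; +_; -[1+_]; ∣_∣)
open import Data.List using (List; []; _∷_; _++_)
open import Data.Nat as ℕ using (ℕ; zero; suc; _+_; _*_; _⊓_; _⊔_; _≤_; _≤ᵇ_; _≡ᵇ_; NonZero; _/_)
open import Data.Product using (_×_; _,_; ∃-syntax)
open import Data.Sum using (_⊎_)
open import Data.Vec using (Vec; lookup; replicate; _[_]≔_)
open import Data.Vec.Functional using (Vector; foldr; head; tail; toList)
open import Function using (_∘_)
open import Relation.Binary.PropositionalEquality using (_≡_)

open import Algebra.Definitions.RawMonoid ℕ.+-0-rawMonoid using () renaming (sum to ∑ℕ)
open import Algebra.Definitions.RawMonoid ℤ.+-0-rawMonoid using () renaming (sum to ∑ℤ)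

------------------------------------------------------------------------
-- The unlimited knapsack problem

minimum : ∀ {m} → Vector ℕ (suc m) → ℕ
minimum f = foldr _⊓_ (head f) (tail f)

minimum-nonZero : ∀ {m} (f : Vector ℕ (suc m)) → (∀ i → NonZero (f i)) → NonZero (minimum f)
minimum-nonZero f f≢0 = go (f≢0 zero) (tail f) (f≢0 ∘ suc)
  where
  ⊓-nonZero : ∀ a b → NonZero a → NonZero b → NonZero (a ⊓ b)
  ⊓-nonZero (suc _) (suc _) _ _ = _

  go : ∀ {z k} → NonZero z → (g : Vector ℕ k) → (∀ i → NonZero (g i)) →
       NonZero (foldr _⊓_ z g)
  go {k = zero}  z≢0 g g≢0 = z≢0
  go {k = suc k} z≢0 g g≢0 =
    ⊓-nonZero (g zero) _ (g≢0 zero) (go z≢0 (tail g) (g≢0 ∘ suc))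

-- There is at least one item and all weights are positive, so that w* exists
-- and W / w* makes sense.  Values may be negative.
record Knapsack : Set where
  field
    n-1             : ℕ
    W               : ℕ
    weight          : Fin (suc n-1) → ℕ
    value           : Fin (suc n-1) → ℤ
    weight-positive : ∀ i → NonZero (weight i)

  n : ℕ
  n = suc n-1

  w* : ℕ
  w* = minimum weight

  instance
    w*-nonZero : NonZero w*
    w*-nonZero = minimum-nonZero weight weight-positive

  -- Rounded down, which only makes an upper bound in terms of rank stronger.
  rank : ℕ
  rank = W / w*

  -- A selection gives the number of copies taken of each item.
  Selection : Set
  Selection = Fin n → ℕ

  totalWeight : Selection → ℕ
  totalWeight s = ∑ℕ (λ i → s i * weight i)

  totalValue : Selection → ℤ
  totalValue s = ∑ℤ (λ i → + s i ℤ.* value i)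

  Feasible : Selection → Set
  Feasible s = totalWeight s ≤ W

  IsOptimum : ℤ → Set
  IsOptimum x = (∃[ s ] (Feasible s × totalValue s ≡ x))
              × (∀ s → Feasible s → totalValue s ℤ.≤ x)

  -- Bounds every number in the instance; used to fix the word length.
  size : ℕ
  size = 2 + n + W + ∑ℕ weight + ∑ℕ (∣_∣ ∘ value)

------------------------------------------------------------------------
-- Binary-forking RAM

Register : ℕ → Set
Register k = Fin k

Label : Set
Label = ℕ

data ArithOp : Set where
  add sub mul div : ArithOp

data Instr (k : ℕ) : Set where
  const : Register k → ℤ → Instr k
  -- arith o r s t  is  r ← s o t
  arith : ArithOp → Register k → Register k → Register k → Instr k
  -- load r a  is  r ← mem[a];   store a r  is  mem[a] ← r
  load  : Register k → Register k → Instr k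
  store : Register k → Register k → Instr k
  -- test-and-set r a  is the atomic  r ← mem[a] ; mem[a] ← 1
  test-and-set : Register k → Register k → Instr k
  jump  : Label → Instr k
  -- jump-if-≤ r s l  jumps to l when r ≤ s
  jump-if-≤ : Register k → Register k → Label → Instr k
  -- The children start at the two labels with copies of the parent's
  -- registers; the parent is resumed at the next instruction.
  fork  : Label → Label → Instr k
  halt  : Instr k

-- The number of registers of a thread is a constant of the program.
record Program : Set where
  field
    registers : ℕ
    code      : List (Instr registers)

-- Running off the end of the code terminates the thread.
fetch : ∀ {k} → List (Instr k) → Label → Instr k
fetch []       _       = halt
fetch (i ∷ _)  zero    = i
fetch (_ ∷ is) (suc l) = fetch is l

Memory : Set
Memory = ℕ → ℤ

_[_↦_] : Memory → ℕ → ℤ → Memory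
(m [ a ↦ x ]) b = if a ≡ᵇ b then x else m b

-- Registers and program counter of a thread.
Local : ℕ → Set
Local k = Vec ℤ k × Label

data Outcome (k : ℕ) : Set where
  next  : Memory → Local k → Outcome k
  split : (left right resume : Local k) → Outcome k
  exit  : Outcome k
  fault : Outcome k

-- B is the largest absolute value that fits in a word.  A thread faults, and is
-- stuck from then on, on overflow, on division by zero, and on a negative address.
module _ (B : ℕ) {k : ℕ} where

  setRegister : Memory → Local k → Register k → ℤ → Outcome k
  setRegister m (ρ , pc) r x =
    if ∣ x ∣ ≤ᵇ B then next m (ρ [ r ]≔ x , suc pc) else fault

  divide : Memory → Local k → Register k → ℤ → ℤ → Outcome k
  divide m l r x (+ zero)     = fault
  divide m l r x y@(+ suc _)  = setRegister m l r (x ℤ./ y)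
  divide m l r x y@(-[1+ _ ]) = setRegister m l r (x ℤ./ y)

  execute : Memory → Local k → Instr k → Outcome k
  execute m l        (const r x)       = setRegister m l r x
  execute m l@(ρ , _) (arith add r s t) = setRegister m l r (lookup ρ s ℤ.+ lookup ρ t)
  execute m l@(ρ , _) (arith sub r s t) = setRegister m l r (lookup ρ s ℤ.- lookup ρ t)
  execute m l@(ρ , _) (arith mul r s t) = setRegister m l r (lookup ρ s ℤ.* lookup ρ t)
  execute m l@(ρ , _) (arith div r s t) = divide m l r (lookup ρ s) (lookup ρ t)
  execute m l@(ρ , _) (load r a) with lookup ρ a
  ... | + i      = setRegister m l r (m i)
  ... | -[1+ _ ] = fault
  execute m (ρ , pc) (store a r) with lookup ρ a
  ... | + i      = next (m [ i ↦ lookup ρ r ]) (ρ , suc pc)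
  ... | -[1+ _ ] = fault
  execute m l@(ρ , _) (test-and-set r a) with lookup ρ a
  ... | + i      = setRegister (m [ i ↦ + 1 ]) l r (m i)
  ... | -[1+ _ ] = fault
  execute m (ρ , _)  (jump l)          = next m (ρ , l)
  execute m (ρ , pc) (jump-if-≤ r s l) =
    next m (ρ , (if lookup ρ r ℤ.≤ᵇ lookup ρ s then l else suc pc))
  execute m (ρ , pc) (fork l₁ l₂)      = split (ρ , l₁) (ρ , l₂) (ρ , suc pc)
  execute m l        halt              = exit

-- The clock t of a running or finished thread is the length of the longest chain
-- of dependent instructions (dependence being program order, fork and join) that
-- ends with the latest instruction of that thread.
data Threads (k : ℕ) : Set where
  running  : (t : ℕ) → Local k → Threads k
  waiting  : Local k → (left right : Threads k) → Threads k
  finished : (t : ℕ) → Threads k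

State : ℕ → Set
State k = Memory × Threads k

module Semantics (B : ℕ) (P : Program) where
  open Program P renaming (registers to k)

  perform : Memory → Local k → Outcome k
  perform m l@(_ , pc) = execute B m l (fetch code pc)

  -- Sequentially consistent shared memory with arbitrary interleaving: each step
  -- is one instruction of one thread.  Resuming a parent also counts as an
  -- instruction.
  data _⟶_ : State k → State k → Set where
    step : ∀ {m m′ t l l′} → perform m l ≡ next m′ l′ →
           (m , running t l) ⟶ (m′ , running (suc t) l′)
    forking : ∀ {m t l l₁ l₂ l′} → perform m l ≡ split l₁ l₂ l′ →
              (m , running t l) ⟶
              (m , waiting l′ (running (suc t) l₁) (running (suc t) l₂))
    halting : ∀ {m t l} → perform m l ≡ exit →
              (m , running t l) ⟶ (m , finished (suc t))
    joining : ∀ {m l t₁ t₂} →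
              (m , waiting l (finished t₁) (finished t₂)) ⟶
              (m , running (suc (t₁ ⊔ t₂)) l)
    left  : ∀ {m m′ l T₁ T₁′ T₂} → (m , T₁) ⟶ (m′ , T₁′) →
            (m , waiting l T₁ T₂) ⟶ (m′ , waiting l T₁′ T₂)
    right : ∀ {m m′ l T₁ T₂ T₂′} → (m , T₂) ⟶ (m′ , T₂′) →
            (m , waiting l T₁ T₂) ⟶ (m′ , waiting l T₁ T₂′)

  data _⟶[_]_ : State k → ℕ → State k → Set where
    stop : ∀ {σ} → σ ⟶[ 0 ] σ
    _◅_  : ∀ {σ σ′ σ″ t} → σ ⟶ σ′ → σ′ ⟶[ t ] σ″ → σ ⟶[ suc t ] σ″

  start : Memory → State k
  start m = m , running 0 (replicate k (+ 0) , 0)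

  -- However the threads are scheduled, execution from memory m₀ never gets stuck
  -- before the root thread has finished, it finishes within the given work and
  -- span, and the final memory satisfies Post.
  record Computes (m₀ : Memory) (Post : Memory → Set) (work span : ℕ) : Set where
    field
      work-bound : ∀ {t σ} → start m₀ ⟶[ t ] σ → t ≤ work
      progress   : ∀ {t m T} → start m₀ ⟶[ t ] (m , T) →
                   (∃[ s ] T ≡ finished s) ⊎ (∃[ σ ] (m , T) ⟶ σ)
      span-bound : ∀ {t m s} → start m₀ ⟶[ t ] (m , finished s) → s ≤ span
      correct    : ∀ {t m s} → start m₀ ⟶[ t ] (m , finished s) → Post m

open Semantics public using (Computes)

------------------------------------------------------------------------
-- Input and output conventions

-- Memory holding the given words from address 0 on, and 0 everywhere else.
fromList : List ℤ → Memory
fromList []       _       = + 0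
fromList (x ∷ _)  zero    = x
fromList (_ ∷ xs) (suc a) = fromList xs a

input : Knapsack → Memory
input K = fromList (+ n ∷ + W ∷ toList (λ i → + weight i) ++ toList value)
  where open Knapsack K

-- The optimal value is returned in memory cell 0.
OutputsOptimum : Knapsack → Memory → Set
OutputsOptimum K m = Knapsack.IsOptimum K (m 0)

module Submission where

-- Only the weight limits j reachable from W are processed, and no thread ever waits.
-- The maximum over the n items is taken in a heap-shaped binary tree with nodes
-- 1, …, 2n-1, whose leaves are the items.  Every row j is claimed once, by a
-- test-and-set, by a thread that forks over this tree downwards; at the leaf of an
-- item of weight w ≤ j it tries to claim j - w, and at the leaf of a heavier item it
-- delivers the value 0.  Values climb the tree: the two threads that arrive at the
-- children of a node test-and-set a flag, the first one dies and the second one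
-- goes on with the maximum.  The thread that reaches the root knows dp[j], forks
-- over the tree again, and delivers 0 ⊔ (dp[j] + v) at the leaf of each item in row
-- j + w.  Row W has no such successors; its root writes the output.  A global
-- barrier per rank would cost log w*, which log n does not bound.
--
-- The proof calls the stages of this process cells; each cell (stage, j, k) ends
-- with one atomic action.  In any interleaving the cells that were ever started
-- form a duplicate-free list, determined by the list D of performed actions, and a
-- register or memory cell only ever holds a value that is a function of the cell.
-- The O(nW) cells cost O(1) steps each, which bounds the work.  A chain of cells
-- descends through at most rank rows and then ascends through at most rank rows,
-- which bounds the span.  When all threads have finished, the rule by which D
-- determines the started cells forces the root of row W to have been performed.

open import Defs
open import Data.Nat using (ℕ; _*_; _^_; _⊔_)
open import Data.Nat.Logarithm using (⌊log₂_⌋)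
open import Data.Product using (∃-syntax)

open import Algebra.Bundles using (CommutativeMonoid)
import Algebra.Properties.CommutativeMonoid.Sum as Sum
open import Data.Bool using (true; false; if_then_else_; T)
open import Data.Bool.Properties using (T-≡)
open import Data.Empty using (⊥)
open import Data.Fin using (Fin; zero; suc; toℕ; fromℕ<; punchIn; combine; #_)
open import Data.Fin.Properties using (any?; toℕ-fromℕ<; toℕ-injective; toℕ<n; punchInᵢ≢i; injective⇒≤; combine-injective; fromℕ<-injective)
open import Data.Integer as ℤ using (ℤ; +_; ∣_∣)
import Data.Integer.DivMod as ℤ
import Data.Integer.Properties as ℤ
open import Data.List as List using (List; []; _∷_; _++_; length)
open import Data.List.Membership.Propositional using (_∈_; _∉_)
open import Data.List.Membership.Propositional.Properties using (∈-++⁺ˡ; ∈-++⁺ʳ; ∈-++⁻; ∈-lookup)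
open import Data.List.Properties using (length-++)
open import Data.List.Relation.Binary.Permutation.Propositional using (_↭_; ↭-refl; ↭-sym; ↭-trans; ↭-swap; ↭⇒↭ₛ)
open import Data.List.Relation.Binary.Permutation.Propositional.Properties using (∈-resp-↭; ++⁺ˡ; ++⁺ʳ; shift; ++-assoc; ↭-length; shifts)
import Data.List.Relation.Binary.Permutation.Setoid.Properties as Permutation
open import Data.List.Relation.Unary.All using ([]; _∷_)
open import Data.List.Relation.Unary.AllPairs using ([]; _∷_)
open import Data.List.Relation.Unary.Any using (here; there)
open import Data.List.Relation.Unary.Unique.Propositional using (Unique)
import Data.List.Relation.Unary.Unique.Propositional.Properties as Unique
open import Data.Nat as ℕ hiding (_*_; _^_; _⊔_; ℕ)
open import Data.Nat.Divisibility using (divides)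
open import Data.Nat.DivMod using (_mod_; m<n⇒m%n≡m; [m+n]%n≡m%n; m*n/n≡m; +-distrib-/-∣ʳ; m/n≡1+[m∸n]/n; /-monoˡ-≤)
open import Data.Nat.Induction using (<-rec)
open import Data.Nat.Logarithm using (⌊log₂⌋-mono-≤; ⌊log₂⌊n/2⌋⌋≡⌊log₂n⌋∸1)
open import Data.Nat.Properties
open import Data.Nat.Tactic.RingSolver using (solve-∀)
open import Data.Product using (_×_; _,_; proj₁; proj₂)
open import Data.Sum using (_⊎_; inj₁; inj₂; [_,_]′)
open import Data.Unit using (⊤; tt)
open import Data.Vec using (Vec; []; _∷_; lookup; _[_]≔_; replicate)
open import Data.Vec.Functional using (Vector; foldr; toList; updateAt; removeAt)
open import Data.Vec.Functional.Properties using (updateAt-updates; updateAt-minimal)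
open import Function using (_∘_; Equivalence)
open import Level using (Level)
open import Relation.Binary.PropositionalEquality
open import Relation.Nullary using (¬_; Dec; yes; no; contradiction)

open import Algebra.Definitions.RawMonoid ℕ.+-0-rawMonoid using () renaming (sum to ∑ℕ)

-- Arithmetic of heap-numbered binary trees

data Child (h : ℕ) : ℕ → Set where
  left  : Child h (h + h)
  right : Child h (suc (h + h))

-- Node `0` counts as its own left child, so the condition `1 ≤ h` is what makes indices grow
-- downwards.
child> : ∀ {h k} → 1 ≤ h → Child h k → h < k
child> {h} 1≤h left  = m<m+n h 1≤h
child> {h} 1≤h right = m<n⇒m<1+n (m<m+n h 1≤h)

child≥1 : ∀ {h k} → 1 ≤ h → Child h k → 1 ≤ k
child≥1 1≤h c = ≤-trans 1≤h (<⇒≤ (child> 1≤h c))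

child< : ∀ {n h k} → h < n → Child h k → k < n + n
child< h<n left  = +-mono-< h<n h<n
child< {n} {h} h<n right = begin-strict
  suc (h + h) <⟨ n<1+n _ ⟩
  suc (suc (h + h)) ≡⟨ cong suc (+-suc h h) ⟨
  suc h + suc h ≤⟨ +-mono-≤ h<n h<n ⟩
  n + n ∎
  where open ≤-Reasoning

half : ℕ → ℕ
half = ⌊_/2⌋

half-child : ∀ {h k} → Child h k → half k ≡ h
half-child {h} left  = sym (n≡⌊n+n/2⌋ h)
half-child {h} right = sym (n≡⌈n+n/2⌉ h)

parent : ∀ k → Child (half k) k
parent 0 = left
parent 1 = right
parent (suc (suc k)) with half k | parent k
... | h | left  = subst (Child (suc h)) (cong suc (+-suc h h)) left
... | h | right = subst (Child (suc h)) (cong (λ x → suc (suc x)) (+-suc h h)) right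

half≥1 : ∀ {k} → 2 ≤ k → 1 ≤ half k
half≥1 (s≤s (s≤s _)) = s≤s z≤n

half< : ∀ {n k} → k < n + n → half k < n
half< {n} {k} k<2n = ≰⇒> λ n≤h → <⇒≱ k<2n (begin
  n + n ≤⟨ +-mono-≤ n≤h n≤h ⟩
  half k + half k ≤⟨ le (parent k) ⟩
  k ∎)
  where
  open ≤-Reasoning
  le : ∀ {h k} → Child h k → h + h ≤ k
  le left = ≤-refl
  le right = n≤1+n _

sibling : ∀ {h k} → Child h k → ℕ
sibling {h} left  = suc (h + h)
sibling {h} right = h + h

sibling-child : ∀ {h k} (c : Child h k) → Child h (sibling c)
sibling-child left  = right
sibling-child right = left

-- The two children of `h` add up to `4h + 1`, so the program finds a sibling by one subtraction,
-- without a test of parity.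
sibling-∸ : ∀ {h k} (c : Child h k) → suc ((h + h) + (h + h)) ≡ sibling c + k
sibling-∸ left      = refl
sibling-∸ {h} right = sym (+-suc (h + h) (h + h))

child-injective : ∀ {h h′ k} → Child h k → Child h′ k → h ≡ h′
child-injective c c′ = trans (sym (half-child c)) (half-child c′)

child≢1 : ∀ {h k} → 1 ≤ h → Child h k → k ≢ 1
child≢1 1≤h c refl = <⇒≱ (child> 1≤h c) 1≤h

-- A node has just two children. A join names two distinct ones, and this places any given child
-- among them.
third-child : ∀ {h k k₁ k₂} → Child h k → Child h k₁ → Child h k₂ → k₂ ≢ k₁ → k ≡ k₁ ⊎ k ≡ k₂
third-child left  left  _     _   = inj₁ refl
third-child right right _     _   = inj₁ refl
third-child _     left  left  k₂≢ = contradiction refl k₂≢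
third-child _     right right k₂≢ = contradiction refl k₂≢
third-child right left  right _   = inj₂ refl
third-child left  right left  _   = inj₂ refl

half-/ : ∀ {h k} → Child h k → + k ℤ./ + 2 ≡ + h
half-/ {h} {k} c = trans (ℤ.div-pos-is-/ℕ (+ k) 2) (cong +_ (go c))
  where
  h*2 : h * 2 ≡ h + h
  h*2 = trans (*-comm h 2) (cong (λ x → h + x) (+-identityʳ h))
  go : ∀ {k} → Child h k → k / 2 ≡ h
  go left  = trans (cong (_/ 2) (sym h*2)) (m*n/n≡m h 2)
  go right = trans (+-distrib-/-∣ʳ 1 {h + h} (divides h (sym h*2)))
                   (trans (cong (_/ 2) (sym h*2)) (m*n/n≡m h 2))

-- The complete binary tree with internal nodes 1, …, n-1 and leaves n, …, 2n-1.
module Heap {n : ℕ} (n≥1 : 1 ≤ n) where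

  -- The recursion runs towards larger indices and is therefore driven by fuel. Fuel `f` suffices at
  -- node `k` when `n ≤ f + k`, because the index grows with every step and the nodes from `n` on
  -- are leaves.
  heapMax : (ℕ → ℤ) → ℕ → ℕ → ℤ
  heapMax g zero    k = g k
  heapMax g (suc f) k with k <? n
  ... | yes _ = heapMax g f (k + k) ℤ.⊔ heapMax g f (suc (k + k))
  ... | no  _ = g k

  fuel-child : ∀ {f k k′} → 1 ≤ k → Child k k′ → n ≤ suc f + k → n ≤ f + k′
  fuel-child {f} {k} 1≤k c n≤ = ≤-trans n≤ (≤-trans (≤-reflexive (sym (+-suc f k))) (+-monoʳ-≤ f (child> 1≤k c)))

  heapMax-leaf : ∀ g f {k} → n ≤ k → heapMax g f k ≡ g k
  heapMax-leaf g zero    n≤k = refl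
  heapMax-leaf g (suc f) {k} n≤k with k <? n
  ... | yes k<n = contradiction k<n (≤⇒≯ n≤k)
  ... | no  _   = refl

  heapMax-cong : ∀ {g g′ f f′ k} → (∀ k → g k ≡ g′ k) → 1 ≤ k → n ≤ f + k → n ≤ f′ + k →
                 heapMax g f k ≡ heapMax g′ f′ k
  heapMax-cong {g} {g′} {zero} {f′} {k} eq 1≤k n≤ n≤′ = trans (eq k) (sym (heapMax-leaf g′ f′ n≤))
  heapMax-cong {g} {g′} {suc f} {zero} {k} eq 1≤k n≤ n≤′ = trans (heapMax-leaf g (suc f) n≤′) (eq k)
  heapMax-cong {g} {g′} {suc f} {suc f′} {k} eq 1≤k n≤ n≤′ with k <? n
  ... | no  _ = eq k
  ... | yes _ = cong₂ ℤ._⊔_ (rec left) (rec right)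
    where
    rec : ∀ {k′} → Child k k′ → heapMax g f k′ ≡ heapMax g′ f′ k′
    rec c = heapMax-cong eq (child≥1 1≤k c) (fuel-child 1≤k c n≤) (fuel-child 1≤k c n≤′)

  -- `⊔` on integers returns one of its arguments, so the maximum is itself a leaf value and
  -- inherits what holds for all of them.
  heapMax-ind : ∀ (P : ℤ → Set) {g f k} → (∀ k → n ≤ k → k < n + n → P (g k)) →
                1 ≤ k → k < n + n → n ≤ f + k → P (heapMax g f k)
  heapMax-ind P {f = zero}  leaf 1≤k k< n≤ = leaf _ n≤ k<
  heapMax-ind P {g} {suc f} {k} leaf 1≤k k< n≤ with k <? n
  ... | no  k≮n = leaf k (≮⇒≥ k≮n) k<
  ... | yes k<n with ℤ.⊔-sel (heapMax g f (k + k)) (heapMax g f (suc (k + k)))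
  ...   | inj₁ eq = subst P (sym eq) (heapMax-ind P {f = f} leaf
    (child≥1 1≤k left) (child< k<n left) (fuel-child 1≤k left n≤))
  ...   | inj₂ eq = subst P (sym eq) (heapMax-ind P {f = f} leaf
    (child≥1 1≤k right) (child< k<n right) (fuel-child 1≤k right n≤))

-- Duplicate-free lists, memory updates and finite sums

unique-disjoint : ∀ {A : Set} {x : A} xs {ys} → Unique (xs ++ ys) → x ∈ ys → x ∉ xs
unique-disjoint (x ∷ xs) u@(_ ∷ _)   y (here refl) = Unique.Unique[x∷xs]⇒x∉xs u (∈-++⁺ʳ xs y)
unique-disjoint (x ∷ xs) (_ ∷ u) y (there p)   = unique-disjoint xs u y p

unique-++ : ∀ {A : Set} {xs ys : List A} → Unique xs → Unique ys → (∀ {x} → x ∈ xs → x ∉ ys) → Unique (xs ++ ys)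
unique-++ u v disjoint = Unique.++⁺ u v λ (p , q) → disjoint p q

unique-↭ : ∀ {A : Set} {xs ys : List A} → xs ↭ ys → Unique xs → Unique ys
unique-↭ {A} p = Permutation.Unique-resp-↭ (setoid A) (↭⇒↭ₛ p)

-- Performing `c` moves it from the live cells to `D`, so the list of all cells only gains `new`.
regroup : ∀ {A : Set} (D : List A) {c new live live′} → c ∷ live′ ↭ new ++ live → (c ∷ D) ++ live′ ↭ new ++ (D ++ live)
regroup D {c} {new} {live} {live′} p = 
  ↭-trans (↭-sym (shift c D live′)) (↭-trans (++⁺ˡ D p) (shifts D new {live}))

lookup-injective : ∀ {A : Set} {xs : List A} → Unique xs → ∀ {i j} → List.lookup xs i ≡ List.lookup xs j → i ≡ j
lookup-injective {xs = x ∷ xs} u       {zero}  {zero}  eq = refl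
lookup-injective {xs = x ∷ xs} u       {zero}  {suc j} eq =
  contradiction (subst (_∈ xs) (sym eq) (∈-lookup j)) (Unique.Unique[x∷xs]⇒x∉xs u)
lookup-injective {xs = x ∷ xs} u       {suc i} {zero}  eq =
  contradiction (subst (_∈ xs) eq (∈-lookup i)) (Unique.Unique[x∷xs]⇒x∉xs u)
lookup-injective {xs = x ∷ xs} (_ ∷ u) {suc i} {suc j} eq = cong suc (lookup-injective u eq)

write-same : ∀ m a x → (m [ a ↦ x ]) a ≡ x
write-same m a x rewrite Equivalence.to T-≡ (≡⇒≡ᵇ a a refl) = refl

write-other : ∀ m {a b} x → b ≢ a → (m [ a ↦ x ]) b ≡ m b
write-other m {a} {b} x b≢a with a ≡ᵇ b in eq
... | true  = contradiction (sym (≡ᵇ⇒≡ a b (Equivalence.from T-≡ eq))) b≢a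
... | false = refl

+-∸ : ∀ {a b} → b ≤ a → + a ℤ.- + b ≡ + (a ∸ b)
+-∸ {a} {b} b≤a = trans (ℤ.m-n≡m⊖n a b) (ℤ.⊖-≥ b≤a)

module _ {c ℓ : Level} (M : CommutativeMonoid c ℓ) where
  open CommutativeMonoid M renaming (Carrier to A)
  open Sum M using (sum; sum-remove; sum-cong-≋)

  -- Here `x` is the contribution of one more copy of item `i`. A general monoid serves the weights
  -- in `ℕ` and the values in `ℤ` at once.
  sum-agree-except : ∀ {n} (f g : Vector A (suc n)) i x → f i ≈ x ∙ g i →
                     (∀ j → j ≢ i → f j ≈ g j) → sum f ≈ x ∙ sum g
  sum-agree-except f g i x fi f≈g =
    trans′ (sum-remove {i = i} f)
    (trans′ (∙-cong fi (sum-cong-≋ {x = removeAt f i} {y = removeAt g i} λ j → f≈g (punchIn i j) (punchInᵢ≢i i j)))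
    (trans′ (assoc x (g i) _) (∙-cong (CommutativeMonoid.refl M) (CommutativeMonoid.sym M (sum-remove {i = i} g)))))
    where trans′ = CommutativeMonoid.trans M

-- The dynamic program and its optimality

module KnapsackValue (K : Knapsack) where
  open Knapsack K

  -- Leaf `k` with `n ≤ k < n + n` belongs to item `k ∸ n`. The remainder agrees with this there and
  -- is defined at every node, so no range proof has to be carried along.
  item : ℕ → Fin n
  item k = k mod n

  itemWeight : ℕ → ℕ
  itemWeight k = weight (item k)

  itemValue : ℕ → ℤ
  itemValue k = value (item k)

  item-surjective : ∀ i → item (n + toℕ i) ≡ i
  item-surjective i = toℕ-injective (begin
    toℕ (item (n + toℕ i)) ≡⟨ toℕ-fromℕ< _ ⟩
    (n + toℕ i) % n        ≡⟨ cong (_% n) (+-comm n (toℕ i)) ⟩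
    (toℕ i + n) % n        ≡⟨ [m+n]%n≡m%n (toℕ i) n ⟩
    toℕ i % n              ≡⟨ m<n⇒m%n≡m (toℕ<n i) ⟩
    toℕ i                  ∎)
    where open ≡-Reasoning

  open Heap {n} (s≤s z≤n)

  mutual
    -- The recurrence descends to smaller rows, which again takes fuel: `best f j` is independent of
    -- `f` once `j < f`, and `leafValue f j` once `j ≤ f`. The `0` of the recurrence is moved into
    -- the leaves.
    leafValue : ℕ → ℕ → ℕ → ℤ
    leafValue f j k with itemWeight k ≤? j
    ... | yes _ = + 0 ℤ.⊔ (best f (j ∸ itemWeight k) ℤ.+ itemValue k)
    ... | no  _ = + 0

    best : ℕ → ℕ → ℤ
    best zero    j = + 0
    best (suc f) j = heapMax (leafValue f j) n 1

  -- val j k is the maximum over the leaves below node k; val j 1 is dp[j] of the paper.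
  val : ℕ → ℕ → ℤ
  val j = heapMax (leafValue j j) n

  weight>0 : ∀ i → 1 ≤ weight i
  weight>0 i = >-nonZero⁻¹ (weight i) {{weight-positive i}}

  smaller : ∀ {j k} → itemWeight k ≤ j → j ∸ itemWeight k < j
  smaller {j} {k} w≤j = ∸-monoʳ-< (weight>0 (item k)) w≤j

  best-fuel : ∀ {f f′ j} → j < f → j < f′ → best f j ≡ best f′ j
  leafValue-fuel : ∀ {f f′ j} → j ≤ f → j ≤ f′ → ∀ k → leafValue f j k ≡ leafValue f′ j k

  best-fuel {suc f} {suc f′} j<f j<f′ =
    heapMax-cong {f = n} {n} (leafValue-fuel (s≤s⁻¹ j<f) (s≤s⁻¹ j<f′)) ≤-refl (m≤m+n n 1) (m≤m+n n 1)

  leafValue-fuel {f} {f′} {j} j≤f j≤f′ k with itemWeight k ≤? j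
  ... | no  _   = refl
  ... | yes w≤j = cong (λ x → + 0 ℤ.⊔ (x ℤ.+ itemValue k))
    (best-fuel (<-≤-trans (smaller {k = k} w≤j) j≤f) (<-≤-trans (smaller {k = k} w≤j) j≤f′))

  val-node : ∀ {j k} → 1 ≤ k → k < n → val j k ≡ val j (k + k) ℤ.⊔ val j (suc (k + k))
  val-node {j} {k} 1≤k k<n with k <? n
  ... | no k≮n = contradiction k<n k≮n
  ... | yes _  = cong₂ ℤ._⊔_ (rec left) (rec right)
    where
    rec : ∀ {k′} → Child k k′ → heapMax (leafValue j j) n-1 k′ ≡ val j k′
    rec c = heapMax-cong (λ _ → refl) (child≥1 1≤k c) (fuel-child 1≤k c (m≤m+n n k)) (m≤m+n n _)

  val-skip : ∀ {j k} → n ≤ k → j < itemWeight k → val j k ≡ + 0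
  val-skip {j} {k} n≤k j<w rewrite heapMax-leaf (leafValue j j) n n≤k with itemWeight k ≤? j
  ... | yes w≤j = contradiction w≤j (<⇒≱ j<w)
  ... | no  _   = refl

  val-take : ∀ {j k} → n ≤ k → val (j + itemWeight k) k ≡ + 0 ℤ.⊔ (val j 1 ℤ.+ itemValue k)
  val-take {j} {k} n≤k
    rewrite heapMax-leaf (leafValue (j + itemWeight k) (j + itemWeight k)) n n≤k
    with itemWeight k ≤? j + itemWeight k
  ... | no  w≰ = contradiction (m≤n+m _ j) w≰
  ... | yes w≤ rewrite m+n∸n≡m j (itemWeight k) = cong (λ x → + 0 ℤ.⊔ (x ℤ.+ itemValue k))
    (best-fuel {j = j} (subst (_< j + itemWeight k) (m+n∸n≡m j (itemWeight k)) (smaller {k = k} w≤)) ≤-refl)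

  val-leaf : ∀ (P : ℤ → Set) {j k} → n ≤ k → P (+ 0) →
             (∀ {j′} → j ≡ j′ + itemWeight k → P (val j′ 1 ℤ.+ itemValue k)) → P (val j k)
  val-leaf P {j} {k} n≤k P0 Pv with itemWeight k ≤? j
  ... | no  w≰j = subst P (sym (val-skip n≤k (≰⇒> w≰j))) P0
  ... | yes w≤j with j ∸ itemWeight k | m∸n+n≡m w≤j
  ...   | j′ | refl = subst P (sym (val-take {j′} n≤k)) (max (ℤ.⊔-sel (+ 0) _))
    where
    x : ℤ
    x = val j′ 1 ℤ.+ itemValue k

    max : + 0 ℤ.⊔ x ≡ + 0 ⊎ + 0 ℤ.⊔ x ≡ x → P (+ 0 ℤ.⊔ x)
    max (inj₁ eq) = subst P (sym eq) P0
    max (inj₂ eq) = subst P (sym eq) (Pv refl)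

  -- A value is either `0` or the root value of a lighter row plus the value of one item, so an
  -- induction over rows has only these two cases. It yields both the size bound and the
  -- achievability of `val`.
  val-ind : ∀ (P : ℕ → ℤ → Set) → (∀ j → P j (+ 0)) →
            (∀ j k → n ≤ k → P j (val j 1) → P (j + itemWeight k) (val j 1 ℤ.+ itemValue k)) →
            ∀ j {k} → 1 ≤ k → k < n + n → P j (val j k)
  val-ind P P0 Pv = <-rec _ λ j rec {k} 1≤k k< →
    heapMax-ind (P j) (λ k′ n≤k′ k′< → subst (P j) (heapMax-leaf (leafValue j j) n n≤k′)
      (val-leaf (P j) n≤k′ (P0 j) λ { {j′} refl → Pv j′ k′ n≤k′
        (rec (m<m+n j′ (weight>0 (item k′))) ≤-refl (+-mono-≤ (s≤s z≤n) (s≤s z≤n))) }))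
      1≤k k< (m≤m+n n k)

  0≤val : ∀ j k → 1 ≤ k → k < n + n → + 0 ℤ.≤ val j k
  0≤val j k 1≤k k< = heapMax-ind (+ 0 ℤ.≤_) {g = leafValue j j} {n} nonneg 1≤k k< (m≤m+n n k)
    where
    nonneg : ∀ k → n ≤ k → k < n + n → + 0 ℤ.≤ leafValue j j k
    nonneg k _ _ with itemWeight k ≤? j
    ... | yes _ = ℤ.i≤i⊔j (+ 0) _
    ... | no  _ = ℤ.≤-refl

  val≤root : ∀ j k → 1 ≤ k → k < n + n → val j k ℤ.≤ val j 1
  val≤root j = <-rec _ λ
    { zero rec () _
    ; (suc zero) rec _ _ → ℤ.≤-refl
    ; k@(suc (suc _)) rec _ k< → ℤ.≤-trans (child≤ (half≥1 (s≤s (s≤s z≤n))) (half< {n} k<) (parent k))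
        (rec (child> (half≥1 {k} (s≤s (s≤s z≤n))) (parent k)) (half≥1 {k} (s≤s (s≤s z≤n))) (m≤n⇒m≤n+o n (half< {n} k<))) }
    where
    child≤ : ∀ {h k} → 1 ≤ h → h < n → Child h k → val j k ℤ.≤ val j h
    child≤ {h} 1≤h h<n left  = subst (val j (h + h) ℤ.≤_) (sym (val-node 1≤h h<n)) (ℤ.i≤i⊔j (val j (h + h)) _)
    child≤ {h} 1≤h h<n right = subst (val j (suc (h + h)) ℤ.≤_) (sym (val-node 1≤h h<n)) (ℤ.i≤j⊔i (val j (h + h)) _)

  V : ℕ
  V = ∑ℕ (∣_∣ ∘ value)

  ∑-bounds : ∀ {m} (f : Vector ℕ m) i → f i ≤ ∑ℕ f
  ∑-bounds f zero    = m≤m+n _ _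
  ∑-bounds f (suc i) = ≤-trans (∑-bounds (f ∘ suc) i) (m≤n+m _ (f zero))

  ∣value∣≤V : ∀ i → ∣ value i ∣ ≤ V
  ∣value∣≤V = ∑-bounds (∣_∣ ∘ value)

  value≤V : ∀ i → value i ℤ.≤ + V
  value≤V i = ℤ.≤-trans (i≤∣i∣ (value i)) (ℤ.+≤+ (∣value∣≤V i))
    where
    i≤∣i∣ : ∀ x → x ℤ.≤ + ∣ x ∣
    i≤∣i∣ (+ _)      = ℤ.≤-refl
    i≤∣i∣ ℤ.-[1+ _ ] = ℤ.-≤+

  -- As weights are positive, a limit of `j` admits at most `j` items, each worth at most `V`. The
  -- bound is what lets all values fit into a word.
  val≤ : ∀ j {k} → 1 ≤ k → k < n + n → val j k ℤ.≤ + (j * V)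
  val≤ = val-ind (λ j x → x ℤ.≤ + (j * V)) (λ _ → ℤ.+≤+ z≤n) λ j k n≤k bound → begin
    val j 1 ℤ.+ itemValue k     ≤⟨ ℤ.+-mono-≤ bound (value≤V (item k)) ⟩
    + (j * V) ℤ.+ + V           ≡⟨ cong +_ (+-comm (j * V) V) ⟩
    + (suc j * V)               ≤⟨ ℤ.+≤+ (*-monoˡ-≤ V (m<m+n j (weight>0 (item k)))) ⟩
    + ((j + itemWeight k) * V)  ∎
    where open ℤ.≤-Reasoning

  ∣val∣≤ : ∀ j {k} → 1 ≤ k → k < n + n → ∣ val j k ∣ ≤ j * V
  ∣val∣≤ j {k} 1≤k k< with val j k | 0≤val j k 1≤k k< | val≤ j 1≤k k<
  ... | + x | _ | ℤ.+≤+ x≤ = x≤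

  totalWeight-suc : ∀ s s′ i → s i ≡ suc (s′ i) → (∀ j → j ≢ i → s j ≡ s′ j) →
                    totalWeight s ≡ weight i + totalWeight s′
  totalWeight-suc s s′ i si s≗s′ =
    sum-agree-except +-0-commutativeMonoid (λ j → s j * weight j) (λ j → s′ j * weight j) i (weight i)
      (cong (_* weight i) si) (λ j j≢i → cong (_* weight j) (s≗s′ j j≢i))

  totalValue-suc : ∀ s s′ i → s i ≡ suc (s′ i) → (∀ j → j ≢ i → s j ≡ s′ j) →
                   totalValue s ≡ value i ℤ.+ totalValue s′
  totalValue-suc s s′ i si s≗s′ =
    sum-agree-except ℤ.+-0-commutativeMonoid (λ j → + s j ℤ.* value j) (λ j → + s′ j ℤ.* value j) i (value i)
      (trans (cong (λ x → + x ℤ.* value i) si) (ℤ.suc-* (+ s′ i) (value i)))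
      (λ j j≢i → cong (λ x → + x ℤ.* value j) (s≗s′ j j≢i))

  totalWeight-none : totalWeight (λ _ → 0) ≡ 0
  totalWeight-none = Sum.sum-replicate-zero +-0-commutativeMonoid n

  totalValue-none : ∀ s → (∀ i → s i ≡ 0) → totalValue s ≡ + 0
  totalValue-none s s≡0 =
    trans (Sum.sum-cong-≗ ℤ.+-0-commutativeMonoid {n} λ i → cong (λ x → + x ℤ.* value i) (s≡0 i))
          (Sum.sum-replicate-zero ℤ.+-0-commutativeMonoid n)

  Achievable : ℕ → ℤ → Set
  Achievable j x = ∃[ s ] (totalWeight s ≤ j × totalValue s ≡ x)

  val-achievable : ∀ j → Achievable j (val j 1)
  val-achievable j = val-ind Achievable
    (λ j → (λ _ → 0) , subst (_≤ j) (sym totalWeight-none) z≤n , totalValue-none _ (λ _ → refl))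
    (λ { j k _ (s , w≤j , v≡) → let s′ = updateAt s (item k) suc
                                    si = updateAt-updates (item k) s
                                    sj = λ i i≢k → updateAt-minimal i (item k) s i≢k
                                in s′
        , subst (_≤ j + itemWeight k) (sym (trans (totalWeight-suc s′ s (item k) si sj) (+-comm (itemWeight k) _)))
                (+-monoˡ-≤ (itemWeight k) w≤j)
        , trans (totalValue-suc s′ s (item k) si sj) (trans (ℤ.+-comm (itemValue k) _) (cong (ℤ._+ itemValue k) v≡)) })
    j ≤-refl (+-mono-≤ (s≤s z≤n) (s≤s z≤n))

  -- Remove one copy of some item `i` from the selection. The rest obeys the limit `j ∸ weight i`,
  -- and the leaf of `i` in row `j` accounts for the removed copy. A selection without items is
  -- worth `0`.
  val-upper : ∀ j s → totalWeight s ≤ j → totalValue s ℤ.≤ val j 1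
  val-upper = <-rec _ λ j rec s w≤j → go j rec s w≤j (any? (λ i → 1 ≤? s i))
    where
    go : ∀ j → (∀ {i} → i < j → ∀ s → totalWeight s ≤ i → totalValue s ℤ.≤ val i 1) →
         ∀ s → totalWeight s ≤ j → Dec (∃[ i ] 1 ≤ s i) → totalValue s ℤ.≤ val j 1
    go j rec s w≤j (no none) =
      subst (ℤ._≤ val j 1) (sym (totalValue-none s λ i → n<1⇒n≡0 (≰⇒> λ 1≤si → none (i , 1≤si))))
        (0≤val j 1 ≤-refl (+-mono-≤ (s≤s z≤n) (s≤s z≤n)))
    go j rec s w≤j (yes (i , 1≤si)) = begin
      totalValue s                      ≡⟨ totalValue-suc s s′ i si sj ⟩
      value i ℤ.+ totalValue s′         ≡⟨ ℤ.+-comm (value i) _ ⟩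
      totalValue s′ ℤ.+ value i         ≤⟨ ℤ.+-monoˡ-≤ (value i) (rec j′<j s′ w′≤j′) ⟩
      val j′ 1 ℤ.+ value i              ≡⟨ cong (λ i → val j′ 1 ℤ.+ value i) (item-surjective i) ⟨
      val j′ 1 ℤ.+ itemValue k          ≤⟨ ℤ.i≤j⊔i (+ 0) _ ⟩
      + 0 ℤ.⊔ (val j′ 1 ℤ.+ itemValue k) ≡⟨ val-take {j′} (m≤m+n n (toℕ i)) ⟨
      val (j′ + itemWeight k) k         ≡⟨ cong (λ w → val (j′ + w) k) (cong weight (item-surjective i)) ⟩
      val (j′ + weight i) k             ≡⟨ cong (λ j → val j k) (m∸n+n≡m wi≤j) ⟩
      val j k                           ≤⟨ val≤root j k (s≤s z≤n) (+-monoʳ-< n (toℕ<n i)) ⟩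
      val j 1                           ∎
      where
      open ℤ.≤-Reasoning
      k = n + toℕ i
      s′ = updateAt s i pred
      si = sym (trans (cong suc (updateAt-updates i s)) (suc-pred (s i) {{>-nonZero 1≤si}}))
      sj = λ l l≢i → sym (updateAt-minimal l i s l≢i)
      w+w′≤j = subst (_≤ j) (totalWeight-suc s s′ i si sj) w≤j
      wi≤j = m+n≤o⇒m≤o (weight i) w+w′≤j
      j′ = j ∸ weight i
      j′<j = ∸-monoʳ-< (weight>0 i) wi≤j
      w′≤j′ = m+n≤o⇒m≤o∸n (totalWeight s′) (subst (_≤ j) (+-comm (weight i) _) w+w′≤j)

  val-optimum : IsOptimum (val W 1)
  val-optimum = val-achievable W , val-upper W

-- The program

-- rR holds the length 4n of a row of the working memory, rQ the mode (0 for down,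
-- 1 for up), rJ and rK the row and the node of a cell, and rX its value; rT and rU
-- are scratch.
rN rW r0 r1 rR rQ rJ rK rX rT rU : Register 11
rN = # 0
rW = # 1
r0 = # 2
r1 = # 3
rR = # 4
rQ = # 5
rJ = # 6
rK = # 7
rX = # 8
rT = # 9
rU = # 10

-- The numbers are the labels used by the jumps and the forks.
instructions : List (Instr 11)
instructions =
  -- 0: boot
  load rN rT ∷
  const r1 (+ 1) ∷
  load rW r1 ∷
  arith add rR rN rN ∷
  arith add rR rR rR ∷
  arith add rJ rW r0 ∷
  -- 6: claim j
  arith add rT rJ r1 ∷
  arith mul rT rT rR ∷
  arith add rT rT rN ∷
  arith add rT rT rN ∷
  test-and-set rT rT ∷
  jump-if-≤ r1 rT 15 ∷
  const rK (+ 1) ∷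
  -- 13: tree
  jump-if-≤ rN rK 21 ∷
  -- The resumed parent only halts; results travel through memory, never through the join.
  fork 16 18 ∷
  halt ∷
  arith add rK rK rK ∷
  jump 13 ∷
  arith add rK rK rK ∷
  arith add rK rK r1 ∷
  jump 13 ∷
  -- 21: leaf
  arith add rT rK r1 ∷
  arith add rT rT r1 ∷
  -- The input puts the value of the item at leaf `k` at address `k + 2`, and its weight `n` cells
  -- earlier.
  load rU rT ∷
  arith sub rT rT rN ∷
  load rT rT ∷
  jump-if-≤ r1 rQ 32 ∷
  jump-if-≤ rT rJ 30 ∷
  const rX (+ 0) ∷
  jump 39 ∷
  arith sub rJ rJ rT ∷
  jump 6 ∷
  -- 32: notify
  arith add rJ rJ rT ∷
  jump-if-≤ rJ rW 35 ∷
  halt ∷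
  arith add rX rX rU ∷
  jump-if-≤ r0 rX 39 ∷
  const rX (+ 0) ∷
  jump 39 ∷
  -- 39: put
  arith add rT rJ r1 ∷
  arith mul rT rT rR ∷
  arith add rT rT rK ∷
  store rT rX ∷
  -- 43: meet
  jump-if-≤ rK r1 65 ∷
  arith add rU r1 r1 ∷
  arith div rU rK rU ∷
  -- `rT` is still the address of value cell `k`; the flag of the parent `h` lies `2n + h` beyond
  -- the start of the row.
  arith sub rT rT rK ∷
  arith add rT rT rN ∷
  arith add rT rT rN ∷
  arith add rT rT rU ∷
  test-and-set rT rT ∷
  jump-if-≤ r1 rT 53 ∷
  halt ∷
  -- 53: ascend
  arith add rT rU rU ∷
  arith add rT rT rT ∷
  arith add rT rT r1 ∷
  arith sub rT rT rK ∷
  arith add rK rU r0 ∷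
  arith add rU rJ r1 ∷
  arith mul rU rU rR ∷
  arith add rT rT rU ∷
  load rT rT ∷
  jump-if-≤ rT rX 39 ∷
  arith add rX rT r0 ∷
  jump 39 ∷
  -- 65: root
  jump-if-≤ rW rJ 68 ∷
  const rQ (+ 1) ∷
  jump 13 ∷
  -- 68: output
  store r0 rX ∷
  []

program : Program
program = record { registers = 11 ; code = instructions }

-- Parameters of the correctness proof

-- What the correctness of the program depends on.  wt k and vl k are the weight and
-- the value of the item at leaf k.
record Setup : Set where
  field
    n W B ω : ℕ
    wt  : ℕ → ℕ
    vl  : ℕ → ℤ
    val : ℕ → ℕ → ℤ
    m₀  : Memory

  R : ℕ
  R = (n + n) + (n + n)

  field
    n≥1    : 1 ≤ n
    ω≥1    : NonZero ω
    ω≤wt   : ∀ k → ω ≤ wt k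
    area≤B : (2 + W) * R ≤ B
    -- The program forms `j + wt k` before comparing it with `W`, so the sum has to fit into a word
    -- even if it exceeds `W`.
    wt≤B   : ∀ k → W + wt k ≤ B
    vl≤B   : ∀ k → ∣ vl k ∣ ≤ B
    val≤B  : ∀ {j k} → j ≤ W → 1 ≤ k → k < n + n → ∣ val j k ∣ ≤ B
    sum≤B  : ∀ {j} k → j ≤ W → ∣ val j 1 ℤ.+ vl k ∣ ≤ B
    val-node : ∀ {j k} → 1 ≤ k → k < n → val j k ≡ val j (k + k) ℤ.⊔ val j (suc (k + k))
    val-skip : ∀ {j k} → n ≤ k → j < wt k → val j k ≡ + 0
    val-take : ∀ {j k} → n ≤ k → val (j + wt k) k ≡ + 0 ℤ.⊔ (val j 1 ℤ.+ vl k)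
    m₀-n      : m₀ 0 ≡ + n
    m₀-W      : m₀ 1 ≡ + W
    m₀-weight : ∀ {k} → n ≤ k → k < n + n → m₀ (2 + k ∸ n) ≡ + wt k
    m₀-value  : ∀ {k} → n ≤ k → k < n + n → m₀ (2 + k) ≡ vl k
    m₀-zero   : ∀ {a} → 2 + (n + n) ≤ a → m₀ a ≡ + 0

data Mode : Set where
  down up : Mode

bit : Mode → ℕ
bit down = 0
bit up   = 1

-- tree down and tree up are the nodes of the two fork trees, put j k stores the
-- value of node k of row j, and meet j k is its arrival at the flag of the parent.
data Cell : Set where
  tree     : Mode → ℕ → ℕ → Cell
  put meet : ℕ → ℕ → Cell

-- The work charged for each cell, and the span charged for each unit of height.
abstract
  K : ℕ
  K = 24

  24≤K : 24 ≤ K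
  24≤K = ≤-refl

-- Memory layout and symbolic execution

module Machine (setup : Setup) where
  open Setup setup
  open Semantics B program hiding (Computes)

  -- The first `R` cells are left to the input, which occupies `2 + 2n ≤ R` of them, so row `j`
  -- starts at `suc j * R`. Within a row, values have offsets below `2n` and flags have offsets from
  -- `2n` to `3n - 1`.
  adr : ℕ → ℕ → ℕ
  adr j c = suc j * R + c

  valueAdr flagAdr : ℕ → ℕ → ℕ
  valueAdr j k = adr j k
  -- The flag of node 0 marks the row as claimed.
  flagAdr j h = adr j (n + n + h)

  n≤R : n ≤ R
  n≤R = ≤-trans (m≤m+n n n) (m≤m+n (n + n) (n + n))

  R≤B : R ≤ B
  R≤B = ≤-trans (m≤m+n R _) area≤B

  2≤n+n : 2 ≤ n + n
  2≤n+n = +-mono-≤ n≥1 n≥1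

  1≤B : 1 ≤ B
  1≤B = ≤-trans n≥1 (≤-trans n≤R R≤B)

  adr≤B : ∀ {j c} → j ≤ W → c ≤ R → adr j c ≤ B
  adr≤B {j} {c} j≤W c≤R = begin
    R + j * R + c   ≤⟨ +-mono-≤ (+-monoʳ-≤ R (*-monoˡ-≤ R j≤W)) c≤R ⟩
    R + W * R + R   ≡⟨ +-comm (R + W * R) R ⟩
    (2 + W) * R     ≤⟨ area≤B ⟩
    B               ∎
    where open ≤-Reasoning

  suc≤B : ∀ {j} → j ≤ W → suc j ≤ B
  suc≤B {j} j≤W = ≤-trans (≤-trans (m≤m*n (suc j) R {{>-nonZero (≤-trans n≥1 n≤R)}}) (m≤m+n _ 0)) (adr≤B j≤W z≤n)

  W≤B : W ≤ B
  W≤B = ≤-trans (n≤1+n W) (suc≤B ≤-refl)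

  -- The boot code sets the first five registers once and for all; only the other six vary.
  regs : ℕ → ℕ → ℕ → ℤ → ℤ → ℤ → Vec ℤ 11
  regs q j k x t u = + n ∷ + W ∷ + 0 ∷ + 1 ∷ + R ∷ + q ∷ + j ∷ + k ∷ x ∷ t ∷ u ∷ []

  -- A thread that reaches a state in Goal within r steps that do not change the
  -- memory, as long as the memory satisfies Φ.
  data Reach (Φ : Memory → Set) (Goal : Local 11 → Set) : ℕ → Local 11 → Set where
    here  : ∀ {r l} → Goal l → Reach Φ Goal r l
    there : ∀ {r l l′} → (∀ m → Φ m → perform m l ≡ next m l′) →
            Reach Φ Goal r l′ → Reach Φ Goal (suc r) l

  set-register : ∀ m (l : Local 11) r {x} y → x ≡ y → ∣ y ∣ ≤ B →
                 setRegister B m l r x ≡ next m (proj₁ l [ r ]≔ y , suc (proj₂ l))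
  set-register m l r y refl y≤B rewrite Equivalence.to T-≡ (≤⇒≤ᵇ y≤B) = refl

  jump-taken : ∀ {m ρ pc r s l} → fetch instructions pc ≡ jump-if-≤ r s l → lookup ρ r ℤ.≤ lookup ρ s →
               perform m (ρ , pc) ≡ next m (ρ , l)
  jump-taken {m} {ρ} {pc} {r} {s} {l} i r≤s = trans (cong (execute B m (ρ , pc)) i)
    (cong (λ b → next m (ρ , (if b then l else suc pc))) (Equivalence.to T-≡ (ℤ.≤⇒≤ᵇ r≤s)))

  jump-skipped : ∀ {m ρ pc r s l} → fetch instructions pc ≡ jump-if-≤ r s l → lookup ρ s ℤ.< lookup ρ r →
                 perform m (ρ , pc) ≡ next m (ρ , suc pc)
  jump-skipped {m} {ρ} {pc} {r} {s} {l} i s<r = trans (cong (execute B m (ρ , pc)) i)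
    (cong (λ b → next m (ρ , (if b then l else suc pc)))
          (false! (lookup ρ r ℤ.≤ᵇ lookup ρ s) (λ t → ℤ.<⇒≱ s<r (ℤ.≤ᵇ⇒≤ t))))
    where
    false! : ∀ b → ¬ T b → b ≡ false
    false! true  ¬t = contradiction tt ¬t
    false! false _  = refl

  -- One rule per kind of instruction. With `refl` for the fetch, a chain of rules follows the
  -- program listing, and the arithmetic rules bring each computed word into the form that `regs`
  -- expects.
  module _ {Φ : Memory → Set} {Goal : Local 11 → Set} {fuel pc : ℕ} {ρ : Vec ℤ 11} where

    const▸ : ∀ {r x} → fetch instructions pc ≡ const r x → ∣ x ∣ ≤ B →
             Reach Φ Goal fuel (ρ [ r ]≔ x , suc pc) → Reach Φ Goal (suc fuel) (ρ , pc)
    const▸ i x≤B = there λ m _ → trans (cong (execute B m (ρ , pc)) i) (set-register m (ρ , pc) _ _ refl x≤B)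

    add▸ : ∀ {r s t x} → fetch instructions pc ≡ arith add r s t →
           lookup ρ s ℤ.+ lookup ρ t ≡ x → ∣ x ∣ ≤ B →
           Reach Φ Goal fuel (ρ [ r ]≔ x , suc pc) → Reach Φ Goal (suc fuel) (ρ , pc)
    add▸ i eq x≤B = there λ m _ → trans (cong (execute B m (ρ , pc)) i) (set-register m (ρ , pc) _ _ eq x≤B)

    sub▸ : ∀ {r s t x} → fetch instructions pc ≡ arith sub r s t →
           lookup ρ s ℤ.- lookup ρ t ≡ x → ∣ x ∣ ≤ B →
           Reach Φ Goal fuel (ρ [ r ]≔ x , suc pc) → Reach Φ Goal (suc fuel) (ρ , pc)
    sub▸ i eq x≤B = there λ m _ → trans (cong (execute B m (ρ , pc)) i) (set-register m (ρ , pc) _ _ eq x≤B)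

    mul▸ : ∀ {r s t x} → fetch instructions pc ≡ arith mul r s t →
           lookup ρ s ℤ.* lookup ρ t ≡ x → ∣ x ∣ ≤ B →
           Reach Φ Goal fuel (ρ [ r ]≔ x , suc pc) → Reach Φ Goal (suc fuel) (ρ , pc)
    mul▸ i eq x≤B = there λ m _ → trans (cong (execute B m (ρ , pc)) i) (set-register m (ρ , pc) _ _ eq x≤B)

    div▸ : ∀ {r s t d x} → fetch instructions pc ≡ arith div r s t → lookup ρ t ≡ + suc d →
           lookup ρ s ℤ./ + suc d ≡ x → ∣ x ∣ ≤ B →
           Reach Φ Goal fuel (ρ [ r ]≔ x , suc pc) → Reach Φ Goal (suc fuel) (ρ , pc)
    div▸ {r} {s} {t} {d} {x} i t≡d eq x≤B = there λ m _ → trans (cong (execute B m (ρ , pc)) i)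
      (trans (cong (divide B m (ρ , pc) r (lookup ρ s)) t≡d) (set-register m (ρ , pc) r x eq x≤B))

    load▸ : ∀ {r s a x} → fetch instructions pc ≡ load r s → lookup ρ s ≡ + a →
            (∀ m → Φ m → m a ≡ x) → ∣ x ∣ ≤ B →
            Reach Φ Goal fuel (ρ [ r ]≔ x , suc pc) → Reach Φ Goal (suc fuel) (ρ , pc)
    load▸ {r} {s} {a} {x} i s≡a ma x≤B = there λ m φ → trans (cong (execute B m (ρ , pc)) i) (go m φ)
      where
      go : ∀ m → Φ m → execute B m (ρ , pc) (load r s) ≡ next m (ρ [ r ]≔ x , suc pc)
      go m φ rewrite s≡a = set-register m (ρ , pc) _ _ (ma m φ) x≤B

    jump▸ : ∀ {l} → fetch instructions pc ≡ jump l →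
            Reach Φ Goal fuel (ρ , l) → Reach Φ Goal (suc fuel) (ρ , pc)
    jump▸ i = there λ m _ → cong (execute B m (ρ , pc)) i

    jump-if▸ : ∀ {r s l} → fetch instructions pc ≡ jump-if-≤ r s l → lookup ρ r ℤ.≤ lookup ρ s →
               Reach Φ Goal fuel (ρ , l) → Reach Φ Goal (suc fuel) (ρ , pc)
    jump-if▸ i r≤s = there λ m _ → jump-taken {m} {ρ} {pc} i r≤s

    skip-if▸ : ∀ {r s l} → fetch instructions pc ≡ jump-if-≤ r s l → lookup ρ s ℤ.< lookup ρ r →
               Reach Φ Goal fuel (ρ , suc pc) → Reach Φ Goal (suc fuel) (ρ , pc)
    skip-if▸ i s<r = there λ m _ → jump-skipped {m} {ρ} {pc} i s<r

  -- The code between consecutive actions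

  record Node (j k : ℕ) : Set where
    constructor node
    field
      j≤W : j ≤ W
      1≤k : 1 ≤ k
      k<  : k < n + n

  Valid : Cell → Set
  Valid (tree _ j k) = Node j k
  Valid (put j k)    = Node j k
  Valid (meet j k)   = Node j k

  -- What a thread reads on its way to a cell. Other threads act between its steps, so this must
  -- stay true once it holds: item data is never overwritten, and a value cell is written only once.
  Known : Cell → Memory → Set
  Known (tree _ _ k) m = n ≤ k → m (2 + k) ≡ vl k × m (2 + k ∸ n) ≡ + wt k
  Known (put j h)    m = h < n → ∀ {k} → Child h k → m (valueAdr j k) ≡ val j k
  Known (meet _ _)   m = ⊤

  -- The states in which a thread performs the action of a cell.
  data At : Cell → Local 11 → Set where
    forks : ∀ {q j k x t u} → k < n → (q ≡ up → x ≡ val j 1) →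
            At (tree q j k) (regs (bit q) j k x t u , 14)
    skips : ∀ {j k t u} → n ≤ k → j < wt k → At (tree down j k) (regs 0 j k (+ 0) t u , 29)
    -- Register `rJ` already holds the row `j′` to be claimed, though the cell belongs to row `j`.
    claims : ∀ {j j′ k x u} → n ≤ k → j ≡ j′ + wt k →
             At (tree down j k) (regs 0 j′ k x (+ flagAdr j′ 0) u , 10)
    notifies : ∀ {j k t} → n ≤ k → At (tree up j k) (regs 1 (j + wt k) k (val j 1) t (vl k) , 33)
    puts : ∀ {q j k u} → At (put j k) (regs q j k (val j k) (+ valueAdr j k) u , 42)
    meets : ∀ {q h j k} → 1 ≤ h → Child h k →
            At (meet j k) (regs q j k (val j k) (+ flagAdr j h) (+ h) , 50)
    roots : ∀ {q j k t u} → k ≡ 1 → j < W → At (meet j k) (regs q j k (val j k) t u , 65)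
    outputs : ∀ {q j k t u} → k ≡ 1 → j ≡ W → At (meet j k) (regs q j k (val j k) t u , 68)

  Entry : Cell → ℕ → Local 11 → Set
  Entry c = Reach (Known c) (At c)

  k≤R : ∀ {k} → k < n + n → suc k ≤ R
  k≤R k< = ≤-trans k< (m≤m+n _ _)

  claim-entry : ∀ {Φ Goal fuel j k x t u} → j ≤ W →
    Reach Φ Goal fuel (regs 0 j k x (+ flagAdr j 0) u , 10) →
    Reach Φ Goal (4 + fuel) (regs 0 j k x t u , 6)
  claim-entry {j = j} j≤W =
    add▸ refl (cong +_ (+-comm j 1)) (suc≤B j≤W) ∘
    mul▸ refl (sym (ℤ.pos-* (suc j) R)) (≤-trans (m≤m+n _ 0) (adr≤B j≤W z≤n)) ∘
    add▸ refl refl (adr≤B j≤W n≤R) ∘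
    add▸ refl (cong +_ (trans (+-assoc (suc j * R) n n) (cong (adr j) (sym (+-identityʳ (n + n))))))
      (adr≤B j≤W (≤-trans (≤-reflexive (+-identityʳ (n + n))) (m≤m+n (n + n) (n + n))))

  leaf-entry : ∀ {Goal fuel q j k x t u} → n ≤ k → k < n + n →
    Reach (Known (tree q j k)) Goal fuel (regs (bit q) j k x (+ wt k) (vl k) , 26) →
    Reach (Known (tree q j k)) Goal (6 + fuel) (regs (bit q) j k x t u , 13)
  leaf-entry {q = q} {j} {k} n≤k k< =
    jump-if▸ refl (ℤ.+≤+ n≤k) ∘
    add▸ refl (cong +_ (+-comm k 1)) (≤-trans (k≤R k<) R≤B) ∘
    add▸ refl (cong +_ (+-comm (suc k) 1)) k+2≤B ∘
    load▸ refl refl (λ m known → proj₁ (known n≤k)) (vl≤B k) ∘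
    sub▸ refl (+-∸ (m≤n⇒m≤o+n 2 n≤k)) (≤-trans (m∸n≤m (2 + k) n) k+2≤B) ∘
    load▸ refl refl (λ m known → proj₂ (known n≤k)) (≤-trans (m≤n+m (wt k) W) (wt≤B k))
    where
    k+2≤B : 2 + k ≤ B
    k+2≤B = ≤-trans (s≤s k<) (≤-trans (+-monoˡ-≤ (n + n) (≤-trans (s≤s z≤n) 2≤n+n)) R≤B)

  -- The longest case is a claiming leaf: 6 steps until the item is loaded, 1 to test the mode, 3 to
  -- form the new row and 4 to address its flag. `fuel` pads the bound to a common length.
  tree-entry : ∀ q {j k x t u} fuel → Node j k → (q ≡ up → x ≡ val j 1) →
               Entry (tree q j k) (14 + fuel) (regs (bit q) j k x t u , 13)
  tree-entry q {j} {k} fuel (node j≤W 1≤k k<) x≡ with k <? n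
  tree-entry q fuel (node j≤W 1≤k k<) x≡ | yes k<n = skip-if▸ refl (ℤ.+<+ k<n) (here (forks k<n x≡))
  tree-entry up {j} {k} fuel (node j≤W 1≤k k<) x≡ | no k≮n rewrite x≡ refl = leaf-entry (≮⇒≥ k≮n) k<
    (jump-if▸ refl ℤ.≤-refl
    (add▸ refl refl (≤-trans (+-monoˡ-≤ (wt k) j≤W) (wt≤B k))
    (here (notifies (≮⇒≥ k≮n)))))
  tree-entry down {j} {k} fuel (node j≤W 1≤k k<) x≡ | no k≮n =
    leaf-entry (≮⇒≥ k≮n) k< (skip-if▸ refl (ℤ.+<+ (s≤s z≤n)) (decide (wt k ≤? j)))
    where
    n≤k = ≮⇒≥ k≮n
    decide : ∀ {x u} → Dec (wt k ≤ j) → Entry (tree down j k) (7 + fuel) (regs 0 j k x (+ wt k) u , 27)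
    decide (no  w≰j) = skip-if▸ refl (ℤ.+<+ (≰⇒> w≰j)) (const▸ refl z≤n (here (skips n≤k (≰⇒> w≰j))))
    decide (yes w≤j) =
      jump-if▸ refl (ℤ.+≤+ w≤j)
      (sub▸ refl (+-∸ w≤j) (≤-trans j∸w≤W W≤B)
      (jump▸ refl
      (claim-entry j∸w≤W (here (claims n≤k (sym (m∸n+n≡m w≤j)))))))
      where
      j∸w≤W = ≤-trans (m∸n≤m j (wt k)) j≤W

  put-entry : ∀ {q j k t u} fuel → Node j k →
              Entry (put j k) (3 + fuel) (regs q j k (val j k) t u , 39)
  put-entry {j = j} fuel (node j≤W 1≤k k<) =
    add▸ refl (cong +_ (+-comm j 1)) (suc≤B j≤W)
    (mul▸ refl (sym (ℤ.pos-* (suc j) R)) (≤-trans (m≤m+n _ 0) (adr≤B j≤W z≤n))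
    (add▸ refl refl (adr≤B j≤W (<⇒≤ (k≤R k<)))
    (here puts)))

  meet-entry : ∀ {q j k u} fuel → Node j k →
               Reach (λ _ → ⊤) (At (meet j k)) (8 + fuel) (regs q j k (val j k) (+ valueAdr j k) u , 43)
  meet-entry {j = j} {suc zero} fuel (node j≤W _ k<) with j <? W
  ... | yes j<W = jump-if▸ refl ℤ.≤-refl (here (roots refl j<W))
  ... | no  j≮W with refl ← ≤-antisym j≤W (≮⇒≥ j≮W) =
    jump-if▸ refl ℤ.≤-refl (jump-if▸ refl ℤ.≤-refl (here (outputs refl refl)))
  meet-entry {j = j} {k@(suc (suc _))} fuel (node j≤W _ k<) =
    skip-if▸ refl (ℤ.+<+ (s≤s (s≤s z≤n)))
    (add▸ refl refl (≤-trans 2≤n+n (≤-trans (m≤m+n _ _) R≤B))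
    (div▸ refl refl (half-/ (parent k)) (≤-trans (<⇒≤ h<n) (≤-trans n≤R R≤B))
    (sub▸ refl (trans (+-∸ (m≤n+m k (suc j * R))) (cong +_ (trans (m+n∸n≡m (suc j * R) k) (sym (+-identityʳ _))))) (adr≤B j≤W z≤n)
    (add▸ refl (cong +_ (trans (+-assoc (suc j * R) 0 n) refl)) (adr≤B j≤W n≤R)
    (add▸ refl (cong +_ (+-assoc (suc j * R) n n)) (adr≤B j≤W (m≤m+n _ _))
    (add▸ refl (cong +_ (+-assoc (suc j * R) (n + n) (half k))) (adr≤B j≤W (+-monoʳ-≤ (n + n) (≤-trans (<⇒≤ h<n) (m≤m+n n n))))
    (here (meets (half≥1 {k} (s≤s (s≤s z≤n))) (parent k)))))))))
    where
    h<n = half< {n} k<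

  val-siblings : ∀ {j h k} → 1 ≤ h → h < n → (c : Child h k) → val j h ≡ val j k ℤ.⊔ val j (sibling c)
  val-siblings 1≤h h<n left  = val-node 1≤h h<n
  val-siblings {j} {h} 1≤h h<n right = trans (val-node 1≤h h<n) (ℤ.⊔-comm (val j (h + h)) _)

  node-parent : ∀ {j h k} → 1 ≤ h → Child h k → Node j k → Node j h
  node-parent 1≤h c (node j≤W _ k<) = node j≤W 1≤h (<-trans (child> 1≤h c) k<)

  node-child : ∀ {j h k} → h < n → Child h k → Node j h → Node j k
  node-child h<n c (node j≤W 1≤h _) = node j≤W (child≥1 1≤h c) (child< h<n c)

  child⇒< : ∀ {h k} → Child h k → k < n + n → h < n
  child⇒< c k< = subst (_< n) (half-child c) (half< {n} k<)

  ascend-entry : ∀ {q j h k} fuel → 1 ≤ h → Child h k → Node j k →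
                 Entry (put j h) (16 + fuel) (regs q j k (val j k) (+ 1) (+ h) , 51)
  ascend-entry {q} {j} {h} {k} fuel 1≤h c nd@(node j≤W 1≤k k<) =
    jump-if▸ refl ℤ.≤-refl
    (add▸ refl refl (≤-trans (<⇒≤ h+h<) n+n≤B)
    (add▸ refl refl (≤-trans (+-mono-≤ (<⇒≤ h+h<) (<⇒≤ h+h<)) R≤B)
    (add▸ refl (cong +_ (+-comm _ 1)) (≤-trans (+-mono-≤ h+h< (<⇒≤ h+h<)) R≤B)
    (sub▸ refl (trans (cong (λ x → + x ℤ.- + k) (sibling-∸ c))
                      (trans (+-∸ (m≤n+m k (sibling c))) (cong +_ (m+n∸n≡m (sibling c) k)))) (≤-trans (<⇒≤ s<) n+n≤B)
    (add▸ refl (cong +_ (+-identityʳ h)) (≤-trans (<⇒≤ h<n) (≤-trans n≤R R≤B))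
    (add▸ refl (cong +_ (+-comm j 1)) (suc≤B j≤W)
    (mul▸ refl (sym (ℤ.pos-* (suc j) R)) (≤-trans (m≤m+n _ 0) (adr≤B j≤W z≤n))
    (add▸ refl (cong +_ (+-comm (sibling c) (suc j * R))) (adr≤B j≤W (≤-trans (<⇒≤ s<) (m≤m+n _ _)))
    -- The value of the sibling can be read safely, as its store precedes its arrival at the flag.
    (load▸ refl refl (λ m known → known h<n (sibling-child c)) (val≤B j≤W (child≥1 1≤h (sibling-child c)) s<)
    (maximum (y ℤ.≤? x)))))))))))
    where
    x = val j k
    y = val j (sibling c)
    h<n = child⇒< c k<
    s< = child< h<n (sibling-child c)
    h+h< = child< h<n left
    n+n≤B = ≤-trans (m≤m+n (n + n) (n + n)) R≤B
    finish : ∀ {t u z} fuel → z ≡ val j h → Entry (put j h) (3 + fuel) (regs q j h z t u , 39)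
    finish fuel refl = put-entry fuel (node-parent 1≤h c nd)
    maximum : ∀ {u} → Dec (y ℤ.≤ x) → Entry (put j h) (6 + fuel) (regs q j h x y u , 62)
    maximum (yes y≤x) = jump-if▸ refl y≤x (finish (2 + fuel) (sym (trans (val-siblings 1≤h h<n c) (ℤ.i≥j⇒i⊔j≡i y≤x))))
    maximum (no  y≰x) = skip-if▸ refl (ℤ.≰⇒> y≰x)
      (add▸ refl (ℤ.+-identityʳ y) (val≤B j≤W (child≥1 1≤h (sibling-child c)) s<)
      (jump▸ refl
      (finish fuel (sym (trans (val-siblings 1≤h h<n c) (ℤ.i≤j⇒i⊔j≡j (ℤ.<⇒≤ (ℤ.≰⇒> y≰x))))))))

  push-entry : ∀ {j k t} fuel → n ≤ k → Node (j + wt k) k →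
               Entry (put (j + wt k) k) (7 + fuel) (regs 1 (j + wt k) k (val j 1) t (vl k) , 35)
  push-entry {j} {k} fuel n≤k nd@(node j+w≤W 1≤k k<) =
    add▸ refl refl (sum≤B k (m+n≤o⇒m≤o j j+w≤W)) (decide (+ 0 ℤ.≤? x))
    where
    x = val j 1 ℤ.+ vl k
    finish : ∀ {t u z} fuel → z ≡ val (j + wt k) k → Entry (put (j + wt k) k) (3 + fuel) (regs 1 (j + wt k) k z t u , 39)
    finish fuel refl = put-entry fuel nd
    decide : ∀ {t u} → Dec (+ 0 ℤ.≤ x) → Entry (put (j + wt k) k) (6 + fuel) (regs 1 (j + wt k) k x t u , 36)
    decide (yes 0≤x) = jump-if▸ refl 0≤x (finish (2 + fuel) (sym (trans (val-take n≤k) (ℤ.i≤j⇒i⊔j≡j 0≤x))))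
    decide (no  0≰x) = skip-if▸ refl (ℤ.≰⇒> 0≰x) (const▸ refl z≤n (jump▸ refl
      (finish fuel (sym (trans (val-take n≤k) (ℤ.i≥j⇒i⊔j≡i (ℤ.<⇒≤ (ℤ.≰⇒> 0≰x))))))))

  -- Which cells have been started

  -- Edge D c c′: the action of c may start c′, if the actions of all cells in D
  -- have been performed before.
  data Edge (D : List Cell) : Cell → Cell → Set where
    fork  : ∀ {q j k k′} → k < n → Child k k′ → Edge D (tree q j k) (tree q j k′)
    skip  : ∀ {j k} → n ≤ k → j < wt k → Edge D (tree down j k) (put j k)
    claim : ∀ {j j′ k k′} → n ≤ k → j ≡ j′ + wt k → k′ ≡ 1 → Edge D (tree down j k) (tree down j′ k′)
    push  : ∀ {j j′ k} → n ≤ k → j′ ≡ j + wt k → j′ ≤ W → Edge D (tree up j k) (put j′ k)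
    ready : ∀ {j k} → Edge D (put j k) (meet j k)
    join  : ∀ {j h k s} → 1 ≤ h → Child h k → Child h s → s ≢ k → meet j s ∈ D → Edge D (meet j k) (put j h)
    root  : ∀ {j k k′} → k ≡ 1 → k′ ≡ 1 → j < W → Edge D (meet j k) (tree up j k′)

  -- Starting is determined by the performed actions alone, so thread trees and schedules drop out.
  -- A claimed row or a joined node may have several sources; the flags pick the one that acts.
  Born : List Cell → Cell → Set
  Born D c = c ≡ tree down W 1 ⊎ ∃[ b ] (b ∈ D × Edge D b c)

  weaken : ∀ {D c b b′} → Edge D b b′ → Edge (c ∷ D) b b′
  weaken (fork k<n c)        = fork k<n c
  weaken (skip n≤k j<w)      = skip n≤k j<w
  weaken (claim n≤k j≡ k≡)   = claim n≤k j≡ k≡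
  weaken (push n≤k j≡ j≤W)   = push n≤k j≡ j≤W
  weaken ready               = ready
  weaken (join 1≤h c s s≢ p) = join 1≤h c s s≢ (there p)
  weaken (root k≡ k′≡ j<W)   = root k≡ k′≡ j<W

  born-weaken : ∀ {D c b} → Born D b → Born (c ∷ D) b
  born-weaken (inj₁ eq)          = inj₁ eq
  born-weaken (inj₂ (b , p , e)) = inj₂ (b , there p , weaken e)

  -- The two premises of a join are symmetric, so the new cell can always be
  -- taken as the source of the edge.
  born-cons : ∀ {D c b} → c ∉ D → Born (c ∷ D) b → Born D b ⊎ Edge D c b
  born-cons c∉D (inj₁ eq) = inj₁ (inj₁ eq)
  born-cons c∉D (inj₂ (_ , p , fork k<n c)) = single p (fork k<n c)
    where
    single : ∀ {D c b b′} → b ∈ c ∷ D → Edge D b b′ → Born D b′ ⊎ Edge D c b′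
    single (here refl) e = inj₂ e
    single (there p)   e = inj₁ (inj₂ (_ , p , e))
  born-cons c∉D (inj₂ (_ , here refl , skip n≤k j<w))    = inj₂ (skip n≤k j<w)
  born-cons c∉D (inj₂ (_ , here refl , claim n≤k j≡ k≡)) = inj₂ (claim n≤k j≡ k≡)
  born-cons c∉D (inj₂ (_ , here refl , push n≤k j≡ j≤W)) = inj₂ (push n≤k j≡ j≤W)
  born-cons c∉D (inj₂ (_ , here refl , ready))           = inj₂ ready
  born-cons c∉D (inj₂ (_ , here refl , root k≡ k′≡ j<W)) = inj₂ (root k≡ k′≡ j<W)
  born-cons c∉D (inj₂ (_ , there p , skip n≤k j<w))      = inj₁ (inj₂ (_ , p , skip n≤k j<w))
  born-cons c∉D (inj₂ (_ , there p , claim n≤k j≡ k≡))   = inj₁ (inj₂ (_ , p , claim n≤k j≡ k≡))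
  born-cons c∉D (inj₂ (_ , there p , push n≤k j≡ j≤W))   = inj₁ (inj₂ (_ , p , push n≤k j≡ j≤W))
  born-cons c∉D (inj₂ (_ , there p , ready))             = inj₁ (inj₂ (_ , p , ready))
  born-cons c∉D (inj₂ (_ , there p , root k≡ k′≡ j<W))   = inj₁ (inj₂ (_ , p , root k≡ k′≡ j<W))
  born-cons c∉D (inj₂ (_ , here refl , join 1≤h c s s≢ (here refl))) = contradiction refl s≢
  born-cons c∉D (inj₂ (_ , here refl , join 1≤h c s s≢ (there p)))   = inj₂ (join 1≤h c s s≢ p)
  born-cons c∉D (inj₂ (_ , there p , join 1≤h c s s≢ (here refl)))   = inj₂ (join 1≤h s c (s≢ ∘ sym) p)
  born-cons c∉D (inj₂ (_ , there p , join 1≤h c s s≢ (there p′)))    = inj₁ (inj₂ (_ , p , join 1≤h c s s≢ p′))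

  valid-edge : ∀ {D c c′} → Edge D c c′ → Valid c → Valid c′
  valid-edge (fork k<n c) nd = node-child k<n c nd
  valid-edge (skip _ _) nd = nd
  valid-edge (claim {k = k} n≤k refl refl) (node j≤W _ _) = node (m+n≤o⇒m≤o _ j≤W) ≤-refl 2≤n+n
  valid-edge (push _ _ j≤W) (node _ 1≤k k<) = node j≤W 1≤k k<
  valid-edge ready nd = nd
  valid-edge (join 1≤h c _ _ _) nd = node-parent 1≤h c nd
  valid-edge (root refl refl _) (node j≤W 1≤k k<) = node j≤W 1≤k k<

  Unborn : List Cell → Cell → Set
  Unborn D c = ¬ Born D c

  -- Only the fork of its parent leads to a node other than the root of a fork tree, since `claim`
  -- and `root` edges end at node `1`.
  fork-unborn : ∀ {D q j k k′} → 1 ≤ k → Child k k′ → tree q j k ∉ D → Unborn D (tree q j k′)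
  fork-unborn 1≤k c ∉D (inj₁ refl) = child≢1 1≤k c refl
  fork-unborn 1≤k c ∉D (inj₂ (_ , p , fork _ c′)) with refl ← child-injective c c′ = ∉D p
  fork-unborn 1≤k c ∉D (inj₂ (_ , p , claim _ _ refl)) = child≢1 1≤k c refl
  fork-unborn 1≤k c ∉D (inj₂ (_ , p , root _ refl _)) = child≢1 1≤k c refl

  join-leaf : ∀ {h k} → n ≤ h → Child h k → k < n + n → ⊥
  join-leaf n≤h c k< = <⇒≱ (child⇒< c k<) n≤h

  ready-unborn : ∀ {D j k} → put j k ∉ D → Unborn D (meet j k)
  ready-unborn ∉D (inj₂ (_ , p , ready)) = ∉D p

  module _ {D : List Cell} (valid : ∀ {c} → c ∈ D → Valid c) where

    -- A `put` cell at a leaf comes from `skip` if the item is too heavy for the row and from `push`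
    -- otherwise; at an inner node it comes from `join`. So these kinds of edge never share a
    -- target.
    skip-unborn : ∀ {j k} → n ≤ k → j < wt k → tree down j k ∉ D → Unborn D (put j k)
    skip-unborn n≤k j<w ∉D (inj₂ (_ , p , skip _ _)) = ∉D p
    skip-unborn n≤k j<w ∉D (inj₂ (_ , p , push _ refl _)) = <⇒≱ j<w (m≤n+m _ _)
    skip-unborn n≤k j<w ∉D (inj₂ (_ , p , join _ c _ _ _)) = join-leaf n≤k c (Node.k< (valid p))

    push-unborn : ∀ {j k} → n ≤ k → tree up j k ∉ D → Unborn D (put (j + wt k) k)
    push-unborn n≤k ∉D (inj₂ (_ , p , skip _ j<w)) = <⇒≱ j<w (m≤n+m _ _)
    push-unborn {j} {k} n≤k ∉D (inj₂ (_ , p , push {j = j′} _ eq _)) with refl ← +-cancelʳ-≡ (wt k) j j′ eq = ∉D p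
    push-unborn n≤k ∉D (inj₂ (_ , p , join _ c _ _ _)) = join-leaf n≤k c (Node.k< (valid p))

    -- A join needs the arrival of both children, and `k` is one of them.
    join-unborn : ∀ {j h k} → h < n → Child h k → meet j k ∉ D → Unborn D (put j h)
    join-unborn h<n c ∉D (inj₂ (_ , p , skip n≤h _)) = <⇒≱ h<n n≤h
    join-unborn h<n c ∉D (inj₂ (_ , p , push n≤h _ _)) = <⇒≱ h<n n≤h
    join-unborn h<n c ∉D (inj₂ (_ , p , join _ c₁ c₂ s≢ p′)) with third-child c c₁ c₂ s≢
    ... | inj₁ refl = ∉D p
    ... | inj₂ refl = ∉D p′

    root-unborn : ∀ {j} → meet j 1 ∉ D → Unborn D (tree up j 1)
    root-unborn ∉D (inj₂ (_ , p , fork _ c)) = child≢1 (Node.1≤k (valid p)) c refl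
    root-unborn ∉D (inj₂ (_ , p , root refl _ _)) = ∉D p

  -- The memory invariant and its preservation

  Flag : ℤ → Set → Set
  Flag x A = (x ≡ + 1 × A) ⊎ (x ≡ + 0 × ¬ A)

  flag-map : ∀ {x x′ A A′} → x′ ≡ x → (A → A′) → (A′ → A) → Flag x A → Flag x′ A′
  flag-map refl f g (inj₁ (eq , a))  = inj₁ (eq , f a)
  flag-map refl f g (inj₂ (eq , ¬a)) = inj₂ (eq , ¬a ∘ g)

  Met : List Cell → ℕ → ℕ → Set
  Met D j h = ∃[ k ] (Child h k × meet j k ∈ D)

  -- A claim sets the flag of a row as it starts the row, so `claimed` speaks of birth. A meet sets
  -- the flag of the parent by its own action, so `met` speaks of performed cells.
  record Mem (D : List Cell) (m : Memory) : Set where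
    field
      inputs  : ∀ {k} → n ≤ k → k < n + n → m (2 + k) ≡ vl k × m (2 + k ∸ n) ≡ + wt k
      claimed : ∀ {j} → j ≤ W → Flag (m (flagAdr j 0)) (Born D (tree down j 1))
      met     : ∀ {j h} → j ≤ W → 1 ≤ h → h < n → Flag (m (flagAdr j h)) (Met D j h)
      stored  : ∀ {j k} → Node j k → put j k ∈ D → m (valueAdr j k) ≡ val j k
      output  : meet W 1 ∈ D → m 0 ≡ val W 1

  R≤adr : ∀ j c → R ≤ adr j c
  R≤adr j c = ≤-trans (m≤m+n R (j * R)) (m≤m+n _ c)

  -- Offsets below `R` are last digits of addresses written in base `R`.
  adr-injective : ∀ j j′ {c c′} → c < R → c′ < R → adr j c ≡ adr j′ c′ → j ≡ j′ × c ≡ c′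
  adr-injective zero    zero    c< c′< eq = refl , +-cancelˡ-≡ (R + 0) _ _ eq
  adr-injective zero    (suc j′) {c} {c′} c< c′< eq =
    contradiction (≤-trans (R≤adr j′ c′) (≤-reflexive (sym (shift-row 0 j′ eq)))) (<⇒≱ c<)
    where
    shift-row : ∀ j j′ {c c′} → adr j c ≡ adr (suc j′) c′ → j * R + c ≡ adr j′ c′
    shift-row j j′ eq = +-cancelˡ-≡ R _ _ (trans (sym (+-assoc R (j * R) _)) (trans eq (+-assoc R (suc j′ * R) _)))
  adr-injective (suc j) zero    {c} {c′} c< c′< eq = let e , e′ = adr-injective zero (suc j) c′< c< (sym eq) in sym e , sym e′
  adr-injective (suc j) (suc j′) c< c′< eq =
    let e , e′ = adr-injective j j′ c< c′< (+-cancelˡ-≡ R _ _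
                   (trans (sym (+-assoc R (suc j * R) _)) (trans eq (+-assoc R (suc j′ * R) _))))
    in cong suc e , e′

  valueAdr< : ∀ {k} → k < n + n → k < R
  valueAdr< k< = ≤-trans k< (m≤m+n _ _)

  flagAdr< : ∀ {h} → h < n → n + n + h < R
  flagAdr< h<n = +-monoʳ-< (n + n) (≤-trans h<n (m≤m+n n n))

  valueAdr≢flagAdr : ∀ {j k j′ h} → k < n + n → h < n → valueAdr j k ≢ flagAdr j′ h
  valueAdr≢flagAdr {j} {k} {j′} {h} k< h<n eq with refl ← proj₂ (adr-injective j j′ (valueAdr< k<) (flagAdr< h<n) eq) =
    <⇒≱ k< (m≤m+n _ _)

  valueAdr-injective : ∀ {j k j′ k′} → k < n + n → k′ < n + n → valueAdr j k ≡ valueAdr j′ k′ → j ≡ j′ × k ≡ k′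
  valueAdr-injective {j} {j′ = j′} k< k′< eq = adr-injective j j′ (valueAdr< k<) (valueAdr< k′<) eq

  flagAdr-injective : ∀ {j h j′ h′} → h < n → h′ < n → flagAdr j h ≡ flagAdr j′ h′ → j ≡ j′ × h ≡ h′
  flagAdr-injective {j} {h} {j′} {h′} h< h′< eq =
    let e , e′ = adr-injective j j′ (flagAdr< h<) (flagAdr< h′<) eq in e , +-cancelˡ-≡ (n + n) h h′ e′

  input<R : ∀ {k} → k < n + n → 2 + k < R
  input<R {k} k< = ≤-trans (≤-reflexive (+-comm 2 (suc k))) (+-mono-≤ k< 2≤n+n)

  -- Every write goes to a row, at `R` or beyond, or to the output cell `0`, whose input word `n` is
  -- in a register by then. The item data lies strictly in between.
  inputs-write : ∀ {m a} x → R ≤ a ⊎ a ≡ 0 →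
                 (∀ {k} → n ≤ k → k < n + n → m (2 + k) ≡ vl k × m (2 + k ∸ n) ≡ + wt k) →
                 ∀ {k} → n ≤ k → k < n + n → (m [ a ↦ x ]) (2 + k) ≡ vl k × (m [ a ↦ x ]) (2 + k ∸ n) ≡ + wt k
  inputs-write {m} {a} x far inputs {k} n≤k k< =
    trans (write-other m x (≢a far (input<R k<) (s≤s z≤n))) (proj₁ (inputs n≤k k<)) ,
    trans (write-other m x (≢a far (≤-<-trans (m∸n≤m (2 + k) n) (input<R k<)) (m<n⇒0<n∸m (s≤s (m≤n⇒m≤1+n n≤k)))))
          (proj₂ (inputs n≤k k<))
    where
    ≢a : ∀ {b} → R ≤ a ⊎ a ≡ 0 → b < R → 0 < b → b ≢ a
    ≢a (inj₁ R≤a)  b<R _   refl = <⇒≱ b<R R≤a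
    ≢a (inj₂ refl) _   0<b refl = <⇒≢ 0<b refl

  0≢adr : ∀ {j c} → 0 ≢ adr j c
  0≢adr {j} {c} eq = <⇒≢ (≤-trans (≤-trans n≥1 n≤R) (R≤adr j c)) eq

  there⁻ : ∀ {b c : Cell} {D} → b ≢ c → b ∈ c ∷ D → b ∈ D
  there⁻ b≢c (here eq) = contradiction eq b≢c
  there⁻ b≢c (there p) = p

  born-old : ∀ {D c b} → c ∉ D → ¬ Edge D c b → Born (c ∷ D) b → Born D b
  born-old c∉D ¬e p with born-cons c∉D p
  ... | inj₁ q = q
  ... | inj₂ e = contradiction e ¬e

  -- For the tree cells that write nothing. `¬claim` excludes the claiming leaves, which can change
  -- what `claimed` asserts.
  mem-tree : ∀ {D m q j k} → tree q j k ∉ D → (∀ {j′} → ¬ Edge D (tree q j k) (tree down j′ 1)) →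
             Mem D m → Mem (tree q j k ∷ D) m
  mem-tree ∉D ¬claim mem = record
    { inputs  = inputs
    ; claimed = λ j≤W → flag-map refl born-weaken (born-old ∉D ¬claim) (claimed j≤W)
    ; met     = λ j≤W 1≤h h<n → flag-map refl (λ { (k , c , p) → k , c , there p })
                                  (λ { (k , c , p) → k , c , there⁻ (λ ()) p }) (met j≤W 1≤h h<n)
    ; stored  = λ nd p → stored nd (there⁻ (λ ()) p)
    ; output  = λ p → output (there⁻ (λ ()) p)
    }
    where open Mem mem

  -- Test-and-set writes `1` whether or not the claim succeeds, and row `j′` is born afterwards in
  -- both cases, so both outcomes are covered. Likewise `mem-meet` covers the first and the second
  -- arrival.
  mem-claim : ∀ {D m j j′ k} → n ≤ k → j ≡ j′ + wt k → tree down j k ∉ D →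
              Mem D m → Mem (tree down j k ∷ D) (m [ flagAdr j′ 0 ↦ + 1 ])
  mem-claim {D} {m} {j} {j′} {k} n≤k j≡ ∉D mem = record
    { inputs  = inputs-write {m} _ (inj₁ (R≤adr j′ _)) inputs
    ; claimed = claimed′
    ; met     = λ {i} {h} i≤W 1≤h h<n → flag-map
                  (write-other m _ λ eq → <⇒≢ 1≤h (sym (proj₂ (flagAdr-injective {i} {h} {j′} {0} h<n n≥1 eq))))
                  (λ { (k , c , p) → k , c , there p })
                  (λ { (k , c , p) → k , c , there⁻ (λ ()) p }) (met i≤W 1≤h h<n)
    ; stored  = λ {i} {l} nd p → trans (write-other m _ (valueAdr≢flagAdr {i} {l} {j′} {0} (Node.k< nd) n≥1)) (stored nd (there⁻ (λ ()) p))
    ; output  = λ p → trans (write-other m _ (0≢adr {j′})) (output (there⁻ (λ ()) p))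
    }
    where
    open Mem mem
    claimed′ : ∀ {i} → i ≤ W → Flag ((m [ flagAdr j′ 0 ↦ + 1 ]) (flagAdr i 0)) (Born (tree down j k ∷ D) (tree down i 1))
    claimed′ {i} i≤W with i ≟ j′
    ... | yes refl = inj₁ (write-same m (flagAdr i 0) _ , inj₂ (_ , here refl , claim n≤k j≡ refl))
    ... | no  i≢j′ = flag-map (write-other m _ λ eq → i≢j′ (proj₁ (flagAdr-injective {i} {0} {j′} n≥1 n≥1 eq)))
      born-weaken
      (born-old ∉D λ { (fork k<n _) → <⇒≱ k<n n≤k
                     ; (claim _ eq refl) → i≢j′ (+-cancelʳ-≡ (wt k) i j′ (trans (sym eq) j≡)) })
      (claimed i≤W)

  mem-put : ∀ {D m j k} → Node j k → put j k ∉ D →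
            Mem D m → Mem (put j k ∷ D) (m [ valueAdr j k ↦ val j k ])
  mem-put {D} {m} {j} {k} nd ∉D mem = record
    { inputs  = inputs-write {m} _ (inj₁ (R≤adr j _)) inputs
    ; claimed = λ {i} i≤W → flag-map (write-other m _ (valueAdr≢flagAdr {j} {k} {i} {0} (Node.k< nd) n≥1 ∘ sym))
                  born-weaken (born-old ∉D (λ ())) (claimed i≤W)
    ; met     = λ {i} {h} i≤W 1≤h h<n → flag-map (write-other m _ (valueAdr≢flagAdr {j} {k} {i} {h} (Node.k< nd) h<n ∘ sym))
                  (λ { (k , c , p) → k , c , there p })
                  (λ { (k , c , p) → k , c , there⁻ (λ ()) p }) (met i≤W 1≤h h<n)
    ; stored  = stored′
    ; output  = λ p → trans (write-other m _ (0≢adr {j})) (output (there⁻ (λ ()) p))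
    }
    where
    open Mem mem
    stored′ : ∀ {i l} → Node i l → put i l ∈ put j k ∷ D → (m [ valueAdr j k ↦ val j k ]) (valueAdr i l) ≡ val i l
    stored′ nd′ (here refl) = write-same m (valueAdr j k) _
    stored′ {i} {l} nd′ (there p) = trans
      (write-other m _ λ eq → ∉D (old (valueAdr-injective {i} {l} {j} (Node.k< nd′) (Node.k< nd) eq)))
      (stored nd′ p)
      where
      old : i ≡ j × l ≡ k → put j k ∈ D
      old (refl , refl) = p

  mem-meet : ∀ {D m j h k} → 1 ≤ h → Child h k → Node j k → meet j k ∉ D →
             Mem D m → Mem (meet j k ∷ D) (m [ flagAdr j h ↦ + 1 ])
  mem-meet {D} {m} {j} {h} {k} 1≤h c nd ∉D mem = record
    { inputs  = inputs-write {m} _ (inj₁ (R≤adr j _)) inputs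
    ; claimed = λ {i} i≤W → flag-map
                  (write-other m _ λ eq → <⇒≢ 1≤h (proj₂ (flagAdr-injective {i} {0} {j} {h} n≥1 h<n eq)))
                  born-weaken (born-old ∉D (λ ())) (claimed i≤W)
    ; met     = met′
    ; stored  = λ {i} {l} nd′ p → trans (write-other m _ (valueAdr≢flagAdr {i} {l} {j} {h} (Node.k< nd′) h<n)) (stored nd′ (there⁻ (λ ()) p))
    ; output  = λ p → trans (write-other m _ (0≢adr {j})) (output (there⁻ (λ { refl → child≢1 1≤h c refl }) p))
    }
    where
    open Mem mem
    h<n = child⇒< c (Node.k< nd)
    met′ : ∀ {i l} → i ≤ W → 1 ≤ l → l < n → Flag ((m [ flagAdr j h ↦ + 1 ]) (flagAdr i l)) (Met (meet j k ∷ D) i l)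
    met′ {i} {l} i≤W 1≤l l<n with i ≟ j | l ≟ h
    ... | yes refl | yes refl = inj₁ (write-same m (flagAdr j h) _ , k , c , here refl)
    ... | no i≢j | _ = flag-map (write-other m _ λ eq → i≢j (proj₁ (flagAdr-injective {i} {l} {j} l<n h<n eq)))
      (λ { (k , c , p) → k , c , there p })
      (λ { (k , c , p) → k , c , there⁻ (λ { refl → i≢j refl }) p }) (met i≤W 1≤l l<n)
    ... | _ | no l≢h = flag-map (write-other m _ λ eq → l≢h (proj₂ (flagAdr-injective {i} {l} {j} l<n h<n eq)))
      (λ { (k , c , p) → k , c , there p })
      (λ { (k , c′ , p) → k , c′ , there⁻ (λ { refl → l≢h (child-injective c′ c) }) p }) (met i≤W 1≤l l<n)

  mem-root : ∀ {D m j} → j < W → meet j 1 ∉ D → Mem D m → Mem (meet j 1 ∷ D) m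
  mem-root j<W ∉D mem = record
    { inputs  = inputs
    ; claimed = λ j≤W → flag-map refl born-weaken (born-old ∉D λ ()) (claimed j≤W)
    ; met     = λ j≤W 1≤h h<n → flag-map refl (λ { (k , c , p) → k , c , there p })
                  (λ { (k , c , p) → k , c , there⁻ (λ { refl → child≢1 1≤h c refl }) p }) (met j≤W 1≤h h<n)
    ; stored  = λ nd p → stored nd (there⁻ (λ ()) p)
    ; output  = λ p → output (there⁻ (λ { refl → <⇒≢ j<W refl }) p)
    }
    where open Mem mem

  mem-output : ∀ {D m} → meet W 1 ∉ D → Mem D m → Mem (meet W 1 ∷ D) (m [ 0 ↦ val W 1 ])
  mem-output {D} {m} ∉D mem = record
    { inputs  = inputs-write {m} _ (inj₂ refl) inputs
    ; claimed = λ {i} j≤W → flag-map (write-other m {0} _ (0≢adr {i} ∘ sym)) born-weaken (born-old ∉D λ ()) (claimed j≤W)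
    ; met     = λ {i} j≤W 1≤h h<n → flag-map (write-other m {0} _ (0≢adr {i} ∘ sym)) (λ { (k , c , p) → k , c , there p })
                  (λ { (k , c , p) → k , c , there⁻ (λ { refl → child≢1 1≤h c refl }) p }) (met j≤W 1≤h h<n)
    ; stored  = λ {i} nd p → trans (write-other m {0} _ (0≢adr {i} ∘ sym)) (stored nd (there⁻ (λ ()) p))
    ; output  = λ _ → write-same m 0 (val W 1)
    }
    where open Mem mem

  -- The effect of an action

  index : Cell → ℕ
  index (tree _ _ k) = k
  index (put _ k)    = k
  index (meet _ k)   = k

  -- The cells in `new` are exactly those that the action of `c` makes born. `unborn` keeps the list
  -- of all cells free of duplicates, and `only` keeps it complete.
  record Spawns (D : List Cell) (c : Cell) (new : List Cell) : Set where
    field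
      edges    : ∀ {b} → b ∈ new → Edge D c b
      unborn   : ∀ {b} → b ∈ new → Unborn D b
      only     : ∀ {b} → Edge D c b → Born D b ⊎ b ∈ new
      distinct : Unique new

  spawns-none : ∀ {D c} → (∀ {b} → Edge D c b → Born D b) → Spawns D c []
  spawns-none born = record { edges = λ () ; unborn = λ () ; only = inj₁ ∘ born ; distinct = [] }

  spawns-one : ∀ {D c b} → Edge D c b → Unborn D b → (∀ {b′} → Edge D c b′ → b′ ≡ b) → Spawns D c (b ∷ [])
  spawns-one e u only = record
    { edges    = λ { (here refl) → e }
    ; unborn   = λ { (here refl) → u }
    ; only     = λ e′ → inj₂ (here (only e′))
    ; distinct = [] ∷ []
    }

  Exits : Local 11 → Set
  Exits l = ∀ m → perform m l ≡ exit

  Dying : ℕ → Local 11 → Set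
  Dying = Reach (λ _ → ⊤) Exits

  -- Within 17 steps a thread reaches its next action. The longest route is that to a right child: 3
  -- steps to its number and back to the tree code, and the 14 of `tree-entry`.
  data Action (D : List Cell) (m : Memory) (c : Cell) (l : Local 11) : Set where
    continue : ∀ {m′ l′ b} → perform m l ≡ next m′ l′ → Entry b 17 l′ →
               Spawns D c (b ∷ []) → Mem (c ∷ D) m′ → Action D m c l
    stop     : ∀ {m′ l′} → perform m l ≡ next m′ l′ → Dying 1 l′ →
               Spawns D c [] → Mem (c ∷ D) m′ → Action D m c l
    branch   : ∀ {l₁ l₂ l′ b₁ b₂} → perform m l ≡ split l₁ l₂ l′ → Entry b₁ 17 l₁ → Entry b₂ 17 l₂ → Exits l′ →
               Spawns D c (b₁ ∷ b₂ ∷ []) → Mem (c ∷ D) m → Action D m c l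

  module _ {D : List Cell} {m : Memory} (valid : ∀ {c} → c ∈ D → Valid c) (mem : Mem D m) where

    open Mem mem

    act : ∀ {c l} → At c l → c ∉ D → Valid c → Action D m c l
    act (forks {q} {j} {k} k<n x≡) ∉D nd@(node j≤W 1≤k k<) = branch refl
      (add▸ refl refl (≤-trans (<⇒≤ (child< k<n left)) n+n≤B)
      (jump▸ refl
      (tree-entry q 1 (node-child k<n left nd) x≡)))
      (add▸ refl refl (≤-trans (<⇒≤ (child< k<n left)) n+n≤B)
      (add▸ refl (cong +_ (+-comm (k + k) 1)) (≤-trans (<⇒≤ (child< k<n right)) n+n≤B)
      (jump▸ refl
      (tree-entry q 0 (node-child k<n right nd) x≡))))
      (λ _ → refl)
      (record
        { edges    = λ { (here refl) → fork k<n left ; (there (here refl)) → fork k<n right }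
        ; unborn   = λ { (here refl) → fork-unborn 1≤k left ∉D ; (there (here refl)) → fork-unborn 1≤k right ∉D }
        ; only     = only
        ; distinct = ((λ eq → 1+n≢n (sym (cong index eq))) ∷ []) ∷ [] ∷ []
        })
      (mem-tree ∉D no-claim mem)
      where
      n+n≤B = ≤-trans (m≤m+n (n + n) (n + n)) R≤B
      only : ∀ {b} → Edge D (tree q j k) b → Born D b ⊎ b ∈ tree q j (k + k) ∷ tree q j (suc (k + k)) ∷ []
      only (fork _ left)     = inj₂ (here refl)
      only (fork _ right)    = inj₂ (there (here refl))
      only (skip n≤k _)      = contradiction k<n (≤⇒≯ n≤k)
      only (claim n≤k _ _)   = contradiction k<n (≤⇒≯ n≤k)
      only (push n≤k _ _)    = contradiction k<n (≤⇒≯ n≤k)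
      no-claim : ∀ {i} → ¬ Edge D (tree q j k) (tree down i 1)
      no-claim (fork _ c)      = child≢1 1≤k c refl
      no-claim (claim n≤k _ _) = contradiction k<n (≤⇒≯ n≤k)
    act (skips {j} {k} {t} {u} n≤k j<w) ∉D nd = continue refl
      (subst (λ x → Entry (put j k) 17 (regs 0 j k x t u , 39)) (val-skip n≤k j<w) (put-entry 14 nd))
      (spawns-one (skip n≤k j<w) (skip-unborn valid n≤k j<w ∉D) only)
      (mem-tree ∉D no-claim mem)
      where
      only : ∀ {b} → Edge D (tree down j k) b → b ≡ put j k
      only (fork k<n _)       = contradiction k<n (≤⇒≯ n≤k)
      only (skip _ _)         = refl
      only (claim _ refl _)   = contradiction j<w (m+n≮n _ _)
      no-claim : ∀ {i} → ¬ Edge D (tree down j k) (tree down i 1)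
      no-claim (fork k<n _)     = contradiction k<n (≤⇒≯ n≤k)
      no-claim (claim _ refl _) = contradiction j<w (m+n≮n _ _)
    act (claims {j} {j′} {k} {x} {u} n≤k j≡) ∉D nd@(node j≤W _ _) with claimed j′≤W
      where
      j′≤W = ≤-trans (m≤m+n j′ (wt k)) (≤-trans (≤-reflexive (sym j≡)) j≤W)
    -- The row was claimed before, so the only edge leads to a born cell and the thread dies.
    ... | inj₁ (flag , born) = stop
      (set-register (m [ flagAdr j′ 0 ↦ + 1 ]) (regs 0 j′ k x (+ flagAdr j′ 0) u , 10) rT (+ 1) flag 1≤B)
      (jump-if▸ refl ℤ.≤-refl (here λ _ → refl))
      (spawns-none only)
      (mem-claim n≤k j≡ ∉D mem)
      where
      only : ∀ {b} → Edge D (tree down j k) b → Born D b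
      only (fork k<n _)      = contradiction k<n (≤⇒≯ n≤k)
      only (skip _ j<w)      = contradiction (subst (_< wt k) j≡ j<w) (m+n≮n _ _)
      only (claim {j′ = i} _ eq refl) with refl ← +-cancelʳ-≡ (wt k) i j′ (trans (sym eq) j≡) = born
    ... | inj₂ (flag , unborn) = continue
      (set-register (m [ flagAdr j′ 0 ↦ + 1 ]) (regs 0 j′ k x (+ flagAdr j′ 0) u , 10) rT (+ 0) flag z≤n)
      (skip-if▸ refl (ℤ.+<+ (s≤s z≤n))
      (const▸ refl 1≤B
      (tree-entry down 1 (node (≤-trans (m≤m+n j′ (wt k)) (≤-trans (≤-reflexive (sym j≡)) j≤W)) ≤-refl 2≤n+n) (λ ()))))
      (spawns-one (claim n≤k j≡ refl) unborn only)
      (mem-claim n≤k j≡ ∉D mem)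
      where
      only : ∀ {b} → Edge D (tree down j k) b → b ≡ tree down j′ 1
      only (fork k<n _)      = contradiction k<n (≤⇒≯ n≤k)
      only (skip _ j<w)      = contradiction (subst (_< wt k) j≡ j<w) (m+n≮n _ _)
      only (claim {j′ = i} _ eq refl) = cong (λ i → tree down i 1) (+-cancelʳ-≡ (wt k) i j′ (trans (sym eq) j≡))
    act (notifies {j} {k} {t} n≤k) ∉D nd@(node _ 1≤k k<) with j + wt k ≤? W
    ... | yes j+w≤W = continue (jump-taken {ρ = regs 1 (j + wt k) k (val j 1) t (vl k)} {33} refl (ℤ.+≤+ j+w≤W))
      (push-entry 10 n≤k (node j+w≤W 1≤k k<))
      (spawns-one (push n≤k refl j+w≤W) (push-unborn valid n≤k ∉D) only)
      (mem-tree ∉D (λ ()) mem)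
      where
      only : ∀ {b} → Edge D (tree up j k) b → b ≡ put (j + wt k) k
      only (fork k<n _)    = contradiction k<n (≤⇒≯ n≤k)
      only (push _ refl _) = refl
    ... | no j+w≰W = stop (jump-skipped {ρ = regs 1 (j + wt k) k (val j 1) t (vl k)} {33} refl (ℤ.+<+ (≰⇒> j+w≰W)))
      (here λ _ → refl)
      (spawns-none only)
      (mem-tree ∉D (λ ()) mem)
      where
      only : ∀ {b} → Edge D (tree up j k) b → Born D b
      only (fork k<n _)        = contradiction k<n (≤⇒≯ n≤k)
      only (push _ refl j+w≤W) = contradiction j+w≤W j+w≰W
    act puts ∉D nd = continue refl (meet-entry 9 nd)
      (spawns-one ready (ready-unborn ∉D) (λ { ready → refl }))
      (mem-put nd ∉D mem)
    act (meets {q} {h} {j} {k} 1≤h c) ∉D nd@(node j≤W _ k<) with met j≤W 1≤h (child⇒< c k<)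
    ... | inj₁ (flag , s , c′ , p) = continue
      (set-register (m [ flagAdr j h ↦ + 1 ]) (regs q j k (val j k) (+ flagAdr j h) (+ h) , 50) rT (+ 1) flag 1≤B)
      (ascend-entry 1 1≤h c nd)
      -- The arrival recorded by the flag is not that of `k`, whose meet is still unperformed, so it
      -- is that of the sibling.
      (spawns-one (join 1≤h c c′ (λ { refl → ∉D p }) p) (join-unborn valid (child⇒< c k<) c ∉D) only)
      (mem-meet 1≤h c nd ∉D mem)
      where
      only : ∀ {b} → Edge D (meet j k) b → b ≡ put j h
      only (join _ c″ _ _ _) = cong (put j) (child-injective c″ c)
      only (root refl _ _)   = contradiction refl (child≢1 1≤h c)
    ... | inj₂ (flag , alone) = stop
      (set-register (m [ flagAdr j h ↦ + 1 ]) (regs q j k (val j k) (+ flagAdr j h) (+ h) , 50) rT (+ 0) flag z≤n)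
      (skip-if▸ refl (ℤ.+<+ (s≤s z≤n)) (here λ _ → refl))
      (spawns-none only)
      (mem-meet 1≤h c nd ∉D mem)
      where
      only : ∀ {b} → Edge D (meet j k) b → Born D b
      only (join {s = s} _ c″ cₛ _ p) with refl ← child-injective c″ c = contradiction (s , cₛ , p) alone
      only (root refl _ _)   = contradiction refl (child≢1 1≤h c)
    act (roots {q} {j} {t = t} {u} refl j<W) ∉D nd = continue (jump-skipped {ρ = regs q j 1 (val j 1) t u} {65} refl (ℤ.+<+ j<W))
      (const▸ refl 1≤B
      (jump▸ refl
      (tree-entry up 1 nd (λ _ → refl))))
      (spawns-one (root refl refl j<W) (root-unborn valid ∉D) only)
      (mem-root j<W ∉D mem)
      where
      only : ∀ {b} → Edge D (meet j 1) b → b ≡ tree up j 1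
      only (join 1≤h c _ _ _) = contradiction refl (child≢1 1≤h c)
      only (root _ refl _)    = refl
    act (outputs refl refl) ∉D nd = stop refl (here λ _ → refl) (spawns-none only) (mem-output ∉D mem)
      where
      only : ∀ {b} → Edge D (meet W 1) b → Born D b
      only (join 1≤h c _ _ _) = contradiction refl (child≢1 1≤h c)
      only (root _ _ W<W)     = contradiction W<W (<-irrefl refl)

  -- Heights, which bound chains of actions

  L top : ℕ
  L = suc ⌊log₂ n ⌋
  private instance
    ω-nonZero : NonZero ω
    ω-nonZero = ω≥1

  -- Bounds how many items can still be added to row `j` within `W`, as each weighs at least `ω`.
  ahead : ℕ → ℕ
  ahead j = (W ∸ j) / ω

  lap : ℕ
  lap = 3 + (L + L + L)

  -- Exceeds the heights of all valid cells of the way up, so the whole way down lies above them.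
  top = ahead 0 * lap + lap

  depth : ℕ → ℕ
  depth k = ⌊log₂ k ⌋

  -- Decreases along every edge.  A row takes suc L edges on the way down and lap
  -- edges on the way up.
  height : Cell → ℕ
  height (tree down j k) = j / ω * suc L + (L ∸ depth k) + top
  height (put j k)       = ahead j * lap + (2 + L + (depth k + depth k))
  height (meet j k)      = ahead j * lap + (1 + L + (depth k + depth k))
  height (tree up j k)   = ahead j * lap + (L ∸ depth k)

  depth-child : ∀ {h k} → 1 ≤ h → Child h k → depth k ≡ suc (depth h)
  depth-child {h} {k} 1≤h c = begin
    depth k                  ≡⟨ m+[n∸m]≡n 1≤depth ⟨
    suc (depth k ∸ 1)        ≡⟨ cong suc (⌊log₂⌊n/2⌋⌋≡⌊log₂n⌋∸1 k) ⟨
    suc (depth (half k))     ≡⟨ cong (suc ∘ depth) (half-child c) ⟩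
    suc (depth h)            ∎
    where
    open ≡-Reasoning
    1≤depth : 1 ≤ depth k
    1≤depth = ⌊log₂⌋-mono-≤ {2} (≤-trans (s≤s 1≤h) (child> 1≤h c))

  depth≤L : ∀ {k} → 1 ≤ k → k < n + n → depth k ≤ L
  depth≤L {suc zero}      _ _  = z≤n
  depth≤L {k@(suc (suc _))} _ k< =
    subst (_≤ L) (sym (depth-child (half≥1 {k} (s≤s (s≤s z≤n))) (parent k))) (s≤s (⌊log₂⌋-mono-≤ (<⇒≤ (half< {n} k<))))

  quotient-< : ∀ {a b} → a + ω ≤ b → a / ω < b / ω
  quotient-< {a} {b} a+ω≤b = begin-strict
    a / ω               ≤⟨ /-monoˡ-≤ ω (m+n≤o⇒m≤o∸n a a+ω≤b) ⟩
    (b ∸ ω) / ω         <⟨ n<1+n _ ⟩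
    suc ((b ∸ ω) / ω)   ≡⟨ m/n≡1+[m∸n]/n (m+n≤o⇒n≤o a a+ω≤b) ⟨
    b / ω               ∎
    where open ≤-Reasoning

  put-height : ∀ {k} → 1 ≤ k → k < n + n → 2 + L + (depth k + depth k) < lap
  put-height {k = k} 1≤k k< = s≤s (s≤s (s≤s (≤-trans (+-monoʳ-≤ L (+-mono-≤ d d)) (≤-reflexive (sym (+-assoc L L L))))))
    where d = depth≤L 1≤k k<

  descend : ∀ {k k′} → 1 ≤ k → k < n → Child k k′ → L ∸ depth k′ < L ∸ depth k
  descend {k} {k′} 1≤k k<n c = ∸-monoʳ-< (≤-reflexive (sym eq)) (depth≤L (child≥1 1≤k c) (child< k<n c))
    where eq = depth-child 1≤k c

  -- A claim lowers `j / ω` and a push lowers `ahead j`, because every item weighs at least `ω`. A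
  -- skip drops below `top`. The other edges stay in their row, where the depth or the kind of cell
  -- decides.
  height-edge : ∀ {D c c′} → Edge D c c′ → Valid c → height c′ < height c
  height-edge (fork {down} {j} {k} k<n c) (node _ 1≤k _) =
    +-monoˡ-< top (+-monoʳ-< (j / ω * suc L) (descend 1≤k k<n c))
  height-edge (fork {up} {j} {k} k<n c) (node _ 1≤k _) = +-monoʳ-< (ahead j * lap) (descend 1≤k k<n c)
  height-edge (skip {j} {k} _ _) (node _ 1≤k k<) = <-≤-trans
    (+-mono-≤-< (*-monoˡ-≤ lap (/-monoˡ-≤ ω (∸-monoʳ-≤ W (z≤n {j})))) (put-height 1≤k k<))
    (m≤n+m top (j / ω * suc L + (L ∸ depth k)))
  height-edge (claim {j} {j′} {k} _ j≡ refl) _ = +-monoˡ-< top (begin-strict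
    j′ / ω * suc L + L               <⟨ +-monoʳ-< _ (n<1+n L) ⟩
    j′ / ω * suc L + suc L           ≡⟨ +-comm _ (suc L) ⟩
    suc (j′ / ω) * suc L             ≤⟨ *-monoˡ-≤ (suc L) (quotient-< (≤-trans (+-monoʳ-≤ j′ (ω≤wt k)) (≤-reflexive (sym j≡)))) ⟩
    j / ω * suc L                    ≤⟨ m≤m+n _ _ ⟩
    j / ω * suc L + (L ∸ depth k)    ∎)
    where open ≤-Reasoning
  height-edge (push {j} {j′} {k} _ refl j′≤W) (node _ 1≤k k<) = begin-strict
    ahead j′ * lap + (2 + L + (depth k + depth k))  <⟨ +-monoʳ-< (ahead j′ * lap) (put-height 1≤k k<) ⟩
    ahead j′ * lap + lap                            ≡⟨ +-comm _ lap ⟩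
    suc (ahead j′) * lap                            ≤⟨ *-monoˡ-≤ lap (quotient-< closer) ⟩
    ahead j * lap                                   ≤⟨ m≤m+n _ _ ⟩
    ahead j * lap + (L ∸ depth k)                   ∎
    where
    open ≤-Reasoning
    closer : W ∸ (j + wt k) + ω ≤ W ∸ j
    closer = begin
      W ∸ (j + wt k) + ω        ≤⟨ +-monoʳ-≤ (W ∸ (j + wt k)) (ω≤wt k) ⟩
      W ∸ (j + wt k) + wt k     ≡⟨ cong (_+ wt k) (∸-+-assoc W j (wt k)) ⟨
      W ∸ j ∸ wt k + wt k       ≡⟨ m∸n+n≡m (m+n≤o⇒m≤o∸n (wt k) (subst (_≤ W) (+-comm j (wt k)) j′≤W)) ⟩
      W ∸ j                     ∎
  height-edge (ready {j}) _ = +-monoʳ-< (ahead j * lap) (n<1+n _)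
  height-edge (join {j} {h} {k} 1≤h c _ _ _) _ rewrite depth-child 1≤h c =
    +-monoʳ-< (ahead j * lap) (≤-reflexive (lemma L (depth h)))
    where
    lemma : ∀ L d → suc (2 + L + (d + d)) ≡ 1 + L + (suc d + suc d)
    lemma = solve-∀
  height-edge (root {j} refl refl _) _ = +-monoʳ-< (ahead j * lap) (s≤s (m≤m+n L 0))

  -- The global invariant and the accounting of steps

  record Inv (D live : List Cell) (m : Memory) : Set where
    field
      unique   : Unique (D ++ live)
      sound    : ∀ {c} → c ∈ D ++ live → Born D c
      complete : ∀ {c} → Born D c → c ∈ D ++ live
      valid    : ∀ {c} → c ∈ D ++ live → Valid c
      mem      : Mem D m

  -- `D` holds the performed cells and `live` the started ones still to be performed. New cells were
  -- unborn while all listed ones are born, so no duplicate arises; by `born-cons`, whatever becomes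
  -- born is the target of an edge from `c`.
  fire : ∀ {D c new live live′ m m′} → Inv D live m → c ∈ live → Spawns D c new →
         c ∷ live′ ↭ new ++ live → Mem (c ∷ D) m′ → Inv (c ∷ D) live′ m′
  fire {D} {c} {new} {live} {live′} inv c∈ spawns perm mem′ = record
    { unique   = unique-↭ (↭-sym perm′) (unique-++ distinct unique λ b∈new b∈old → unborn b∈new (sound b∈old))
    ; sound    = λ p → [ (λ q → inj₂ (c , here refl , weaken (edges q))) , (λ q → born-weaken (sound q)) ]′ (old p)
    ; complete = λ born → ∈-resp-↭ (↭-sym perm′) (complete′ born)
    ; valid    = λ p → [ (λ q → valid-edge (edges q) (valid (∈-++⁺ʳ D c∈))) , valid ]′ (old p)
    ; mem      = mem′
    }
    where
    open Inv inv
    open Spawns spawns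
    perm′ : (c ∷ D) ++ live′ ↭ new ++ (D ++ live)
    perm′ = regroup D {new = new} perm
    old : ∀ {b} → b ∈ (c ∷ D) ++ live′ → b ∈ new ⊎ b ∈ D ++ live
    old p = ∈-++⁻ new (∈-resp-↭ perm′ p)
    complete′ : ∀ {b} → Born (c ∷ D) b → b ∈ new ++ (D ++ live)
    complete′ born with born-cons (unique-disjoint D unique c∈) born
    ... | inj₁ b = ∈-++⁺ʳ new (complete b)
    ... | inj₂ e with only e
    ...   | inj₁ b = ∈-++⁺ʳ new (complete b)
    ...   | inj₂ p = ∈-++⁺ˡ p

  -- A tree of threads that is certain to finish by time S.
  data Forest : ℕ → Threads 11 → Set where
    -- The 4 covers the action and, if the thread then dies, its last steps; the height pays for all
    -- that follows.
    live     : ∀ {S t l r} c → Entry c r l → t + (r + (4 + K * height c)) ≤ S → Forest S (running t l)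
    dying    : ∀ {S t l r} → Dying r l → t + suc r ≤ S → Forest S (running t l)
    -- The 2 pays for the join and for the `halt` of the resumed parent.
    waiting  : ∀ {S l T₁ T₂} → Exits l → Forest S T₁ → Forest S T₂ → Forest (2 + S) (waiting l T₁ T₂)
    finished : ∀ {S t} → t ≤ S → Forest S (finished t)

  cells : ∀ {S T} → Forest S T → List Cell
  cells (live c _ _)     = c ∷ []
  cells (dying _ _)      = []
  cells (waiting _ x y)  = cells x ++ cells y
  cells (finished _)     = []

  -- The number of steps up to the next actions, and of those that follow
  -- actions without starting new cells.
  potential : ∀ {S T} → Forest S T → ℕ
  potential (live {r = r} _ _ _) = r + 4
  potential (dying {r = r} _ _)  = suc r
  potential (waiting _ x y)      = 2 + (potential x + potential y)
  potential (finished _)         = 0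

  tick : ∀ {S} t {a} → t + suc a ≤ S → suc t + a ≤ S
  tick {S} t {a} = subst (_≤ S) (+-suc t a)

  -- An edge lowers the height by at least one, which frees `K ≥ 24` units of time; together with
  -- the 4 of the old cell these pay for 28.
  K-step : ∀ {h h′} a → h′ < h → a ≤ 28 → a + K * h′ ≤ 4 + K * h
  K-step {h} {h′} a h′<h a≤ = begin
    a + K * h′         ≤⟨ +-monoˡ-≤ (K * h′) (≤-trans a≤ (+-monoʳ-≤ 4 24≤K)) ⟩
    4 + K + K * h′     ≡⟨ +-assoc 4 K (K * h′) ⟩
    4 + (K + K * h′)   ≡⟨ cong (λ x → 4 + x) (*-suc K h′) ⟨
    4 + K * suc h′     ≤⟨ +-monoʳ-≤ 4 (*-monoʳ-≤ K h′<h) ⟩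
    4 + K * h          ∎
    where open ≤-Reasoning

  span-continue : ∀ {S t r h h′} → h′ < h → t + (r + (4 + K * h)) ≤ S → suc t + (17 + (4 + K * h′)) ≤ S
  span-continue {S} {t} {r} {h} {h′} h′<h ≤S = tick t (≤-trans (+-monoʳ-≤ t
    -- 22 is 1 for the action, 17 to the next action and its reserve of 4.
    (≤-trans (K-step 22 h′<h (≤ᵇ⇒≤ 22 28 tt)) (m≤n+m (4 + K * h) r))) ≤S)

  span-branch : ∀ {S t r h h′} → h′ < h → t + (r + (4 + K * h)) ≤ S → 2 + (suc t + (17 + (4 + K * h′))) ≤ S
  span-branch {S} {t} {r} {h} {h′} h′<h ≤S = tick (2 + t) (tick (suc t) (tick t (≤-trans (+-monoʳ-≤ t
    -- Compared with a single successor, 2 more for the join and the `halt` after it.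
    (≤-trans (K-step 24 h′<h (≤ᵇ⇒≤ 24 28 tt)) (m≤n+m (4 + K * h) r))) ≤S)))

  split-span : ∀ {a b S} → 2 + a ≤ S → 2 + b ≤ S → ∃[ S′ ] (S ≡ 2 + S′ × a ≤ S′ × b ≤ S′)
  split-span (s≤s (s≤s a≤)) (s≤s (s≤s b≤)) = _ , refl , a≤ , b≤

  -- An amortised step: the potential drops by at least one, up to a credit of `K` for each cell
  -- that the step starts.
  data Progress (D : List Cell) {S : ℕ} {T : Threads 11} (x : Forest S T) (m m′ : Memory) (T′ : Threads 11) : Set where
    silent : (x′ : Forest S T′) → m′ ≡ m → cells x′ ≡ cells x → potential x′ < potential x → Progress D x m m′ T′
    fired  : ∀ {c new} (x′ : Forest S T′) → c ∈ cells x → Spawns D c new → c ∷ cells x′ ↭ new ++ cells x →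
             Mem (c ∷ D) m′ → potential x′ < potential x + K * length new → Progress D x m m′ T′

  module _ {D : List Cell} {m : Memory}
    (sound : ∀ {c} → c ∈ D → Born D c) (valid : ∀ {c} → c ∈ D → Valid c) (mem : Mem D m) where

    -- A `put` at an inner node is born from a join, so both children have met. A performed meet is
    -- itself born, hence comes after the `put` that stored its value.
    known : ∀ {c} → Born D c → Valid c → Known c m
    known {tree _ _ k} born nd n≤k = Mem.inputs mem n≤k (Node.k< nd)
    known {meet _ _} _ _ = tt
    known {put j h} (inj₂ (_ , _ , skip n≤h _)) nd h<n = contradiction h<n (≤⇒≯ n≤h)
    known {put j h} (inj₂ (_ , _ , push n≤h _ _)) nd h<n = contradiction h<n (≤⇒≯ n≤h)
    known {put j h} (inj₂ (_ , p , join {s = s} 1≤h c₁ c₂ s≢ p′)) nd h<n {k} c =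
      Mem.stored mem (node-child h<n c nd) (stored-before (sound met))
      where
      met : meet j k ∈ D
      met with third-child c c₁ c₂ s≢
      ... | inj₁ refl = p
      ... | inj₂ refl = p′
      stored-before : Born D (meet j k) → put j k ∈ D
      stored-before (inj₂ (_ , q , ready)) = q

    record Ready (c : Cell) : Set where
      constructor ready-cell
      field
        c∉D    : c ∉ D
        born   : Born D c
        valid-cell : Valid c

    advance : ∀ {S T m′ T′} (x : Forest S T) → (∀ {c} → c ∈ cells x → Ready c) →
              (m , T) ⟶ (m′ , T′) → Progress D x m m′ T′
    advance (live {t = t} c (there f e) ≤S) rdy (step eq)
      with refl ← trans (sym (f m (known (Ready.born (rdy (here refl))) (Ready.valid-cell (rdy (here refl)))))) eq
      = silent (live c e (tick t ≤S)) refl refl ≤-refl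
    advance (live c (there f e) ≤S) rdy (forking eq)
      with () ← trans (sym (f m (known (Ready.born (rdy (here refl))) (Ready.valid-cell (rdy (here refl)))))) eq
    advance (live c (there f e) ≤S) rdy (halting eq)
      with () ← trans (sym (f m (known (Ready.born (rdy (here refl))) (Ready.valid-cell (rdy (here refl)))))) eq
    advance (live {t = t} {r = r} c (here at) ≤S) rdy s with rdy (here refl)
    ... | ready-cell c∉D _ v with act valid mem at c∉D v | s
    ...   | continue eq e sp mem′ | step eq′ with refl ← trans (sym eq) eq′ =
      fired (live _ e (span-continue {t = t} {r} (height-edge (Spawns.edges sp (here refl)) v) ≤S))
        (here refl) sp (↭-swap c _ ↭-refl) mem′
        (≤-trans (≤ᵇ⇒≤ 22 28 tt) (+-mono-≤ (m≤n+m 4 r) (≤-trans 24≤K (m≤m*n K 1))))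
    ...   | continue eq e sp mem′ | forking eq′ with () ← trans (sym eq) eq′
    ...   | continue eq e sp mem′ | halting eq′ with () ← trans (sym eq) eq′
    ...   | stop eq e sp mem′ | step eq′ with refl ← trans (sym eq) eq′ =
      fired (dying e (tick t (≤-trans (+-monoʳ-≤ t (≤-trans (≤-trans (≤ᵇ⇒≤ 3 4 tt) (m≤m+n 4 _)) (m≤n+m _ r))) ≤S)))
        (here refl) sp ↭-refl mem′
        (≤-trans (≤-trans (≤ᵇ⇒≤ 3 4 tt) (m≤n+m 4 r)) (m≤m+n _ _))
    ...   | stop eq e sp mem′ | forking eq′ with () ← trans (sym eq) eq′
    ...   | stop eq e sp mem′ | halting eq′ with () ← trans (sym eq) eq′
    ...   | branch eq e₁ e₂ ex sp mem′ | step eq′ with () ← trans (sym eq) eq′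
    ...   | branch eq e₁ e₂ ex sp mem′ | halting eq′ with () ← trans (sym eq) eq′
    advance (live {S} {t} {r = r} c (here at) ≤S) rdy s | ready-cell c∉D _ v
          | branch eq e₁ e₂ ex sp mem′ | forking eq′
      with refl ← trans (sym eq) eq′
      with _ , refl , ≤S₁ , ≤S₂ ← split-span
             (span-branch {t = t} {r} (height-edge (Spawns.edges sp (here refl)) v) ≤S)
             (span-branch {t = t} {r} (height-edge (Spawns.edges sp (there (here refl))) v) ≤S) =
      fired (waiting ex (live _ e₁ ≤S₁) (live _ e₂ ≤S₂)) (here refl) sp (shifts (c ∷ []) (_ ∷ _ ∷ []) {[]}) mem′
        -- The new potential is 44: 17 + 4 for each child and 2 for the waiting parent. The old
        -- reserve of 4 and the credit of two cells give at least 52.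
        (≤-trans (≤ᵇ⇒≤ 45 52 tt) (+-mono-≤ (m≤n+m 4 r) (≤-trans (*-monoˡ-≤ 2 24≤K) ≤-refl)))
    advance (dying {t = t} (there f e) ≤S) rdy (step eq) with refl ← trans (sym (f m tt)) eq =
      silent (dying e (tick t ≤S)) refl refl ≤-refl
    advance (dying (there f e) ≤S) rdy (forking eq) with () ← trans (sym (f m tt)) eq
    advance (dying (there f e) ≤S) rdy (halting eq) with () ← trans (sym (f m tt)) eq
    advance (dying (here ex) ≤S) rdy (step eq) with () ← trans (sym (ex m)) eq
    advance (dying (here ex) ≤S) rdy (forking eq) with () ← trans (sym (ex m)) eq
    advance (dying {t = t} {r = r} (here ex) ≤S) rdy (halting eq) =
      silent (finished (≤-trans (≤-reflexive (+-comm 1 t)) (≤-trans (+-monoʳ-≤ t (s≤s z≤n)) ≤S))) refl refl (s≤s z≤n)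
    advance (waiting {S} ex (finished {t = t₁} t₁≤S) (finished {t = t₂} t₂≤S)) rdy joining =
      silent (dying {r = 0} (here ex) (subst (_≤ 2 + S) (+-comm 1 _) (s≤s (s≤s (⊔-lub t₁≤S t₂≤S))))) refl refl ≤-refl
    advance (waiting ex x y) rdy (left s) with advance x (rdy ∘ ∈-++⁺ˡ) s
    ... | silent x′ m≡ c≡ p< = silent (waiting ex x′ y) m≡ (cong (_++ cells y) c≡) (s≤s (s≤s (+-monoˡ-< (potential y) p<)))
    ... | fired {c} {new} x′ c∈ sp perm mem′ p< = fired (waiting ex x′ y) (∈-++⁺ˡ c∈) sp
      (↭-trans (++⁺ʳ (cells y) perm) (++-assoc new (cells x) (cells y))) mem′
      (s≤s (s≤s (≤-trans (+-monoˡ-< (potential y) p<)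
        (≤-reflexive (shuffle (potential x) (K * length new) (potential y))))))
      where
      shuffle : ∀ a b c → a + b + c ≡ a + c + b
      shuffle = solve-∀
    advance (waiting ex x y) rdy (right s) with advance y (rdy ∘ ∈-++⁺ʳ (cells x)) s
    ... | silent y′ m≡ c≡ p< = silent (waiting ex x y′) m≡ (cong (cells x ++_) c≡) (s≤s (s≤s (+-monoʳ-< (potential x) p<)))
    ... | fired {c} {new} y′ c∈ sp perm mem′ p< = fired (waiting ex x y′) (∈-++⁺ʳ (cells x) c∈) sp
      (↭-trans (shifts (c ∷ []) (cells x)) (↭-trans (++⁺ˡ (cells x) perm) (shifts (cells x) new))) mem′
      (s≤s (s≤s (≤-trans (+-monoʳ-< (potential x) p<)
        (≤-reflexive (sym (+-assoc (potential x) (potential y) (K * length new)))))))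

    can-step : ∀ {S T} (x : Forest S T) → (∀ {c} → c ∈ cells x → Ready c) →
               (∃[ s ] T ≡ finished s) ⊎ (∃[ σ ] (m , T) ⟶ σ)
    can-step (live c (there f e) _) rdy =
      inj₂ (_ , step (f m (known (Ready.born (rdy (here refl))) (Ready.valid-cell (rdy (here refl))))))
    can-step (live c (here at) _) rdy with act valid mem at (Ready.c∉D (rdy (here refl))) (Ready.valid-cell (rdy (here refl)))
    ... | continue eq _ _ _   = inj₂ (_ , step eq)
    ... | stop eq _ _ _       = inj₂ (_ , step eq)
    ... | branch eq _ _ _ _ _ = inj₂ (_ , forking eq)
    can-step (dying (there f e) _) rdy = inj₂ (_ , step (f m tt))
    can-step (dying (here ex) _) rdy = inj₂ (_ , halting (ex m))
    can-step (finished _) rdy = inj₁ (_ , refl)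
    can-step (waiting ex x y) rdy with can-step x (rdy ∘ ∈-++⁺ˡ)
    ... | inj₂ (_ , s) = inj₂ (_ , left s)
    ... | inj₁ (_ , refl) with can-step y (rdy ∘ ∈-++⁺ʳ (cells x))
    ...   | inj₂ (_ , s)    = inj₂ (_ , right s)
    ...   | inj₁ (_ , refl) = inj₂ (_ , joining)

  -- Termination forces the output

  module _ {D : List Cell} (done : ∀ {c} → Born D c → c ∈ D) (valid : ∀ {c} → c ∈ D → Valid c) where

    follow : ∀ {b c} → b ∈ D → Edge D b c → c ∈ D
    follow p e = done (inj₂ (_ , p , e))

    tree-done : ∀ {q j} → tree q j 1 ∈ D → ∀ k → 1 ≤ k → k < n + n → tree q j k ∈ D
    tree-done p = <-rec _ λ
      { (suc zero) rec _ _ → p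
      ; k@(suc (suc _)) rec _ k< →
          let 1≤h = half≥1 {k} (s≤s (s≤s z≤n))
              h<n = half< {n} k<
          in follow (rec (child> 1≤h (parent k)) 1≤h (m≤n⇒m≤n+o n h<n)) (fork h<n (parent k)) }

    meet-done : ∀ {j} → (∀ k → n ≤ k → k < n + n → meet j k ∈ D) →
                ∀ f {k} → n ≤ f + k → 1 ≤ k → k < n + n → meet j k ∈ D
    meet-done leaves zero    n≤ 1≤k k< = leaves _ n≤ k<
    meet-done {j} leaves (suc f) {k} n≤ 1≤k k< with k <? n
    ... | no  k≮n = leaves _ (≮⇒≥ k≮n) k<
    -- With both children met, either can serve as the later arrival of the join.
    ... | yes k<n = follow (follow (child-done left) (join 1≤k left right (1+n≢n) (child-done right))) ready
      where
      child-done : ∀ {k′} → Child k k′ → meet j k′ ∈ D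
      child-done {k′} c = meet-done leaves f
        (≤-trans n≤ (≤-trans (≤-reflexive (sym (+-suc f k))) (+-monoʳ-≤ f (child> 1≤k c))))
        (child≥1 1≤k c) (child< k<n c)

    -- Every leaf of row `j` receives a value: a too heavy item is skipped, and otherwise the
    -- lighter row was claimed, has a performed root by induction, and pushes its result back to
    -- this leaf. The values then meet all the way up.
    root-done : ∀ j → tree down j 1 ∈ D → meet j 1 ∈ D
    root-done = <-rec _ λ j rec p → meet-done (λ k n≤k k< →
        follow (leaf j rec k n≤k k< (tree-done p k (≤-trans n≥1 n≤k) k<) (wt k ≤? j)) ready)
      n (m≤m+n n 1) ≤-refl 2≤n+n
      where
      leaf : ∀ j → (∀ {i} → i < j → tree down i 1 ∈ D → meet i 1 ∈ D) →
             ∀ k → n ≤ k → k < n + n → tree down j k ∈ D → Dec (wt k ≤ j) → put j k ∈ D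
      leaf j rec k n≤k k< p (no  w≰j) = follow p (skip n≤k (≰⇒> w≰j))
      leaf j rec k n≤k k< p (yes w≤j) = follow
        (tree-done (follow (rec i<j (follow p (claim n≤k j≡ refl))) (root refl refl (<-≤-trans i<j j≤W))) k (≤-trans n≥1 n≤k) k<)
        (push n≤k j≡ j≤W)
        where
        j≤W = Node.j≤W (valid p)
        j≡ : j ≡ j ∸ wt k + wt k
        j≡ = sym (m∸n+n≡m w≤j)
        i<j : j ∸ wt k < j
        i<j = ∸-monoʳ-< (≤-trans (>-nonZero⁻¹ ω {{ω≥1}}) (ω≤wt k)) w≤j

  -- Counting the cells

  cell-count : ℕ
  cell-count = 4 * suc W * (n + n)

  kind : Cell → Fin 4
  kind (tree down _ _) = # 0
  kind (tree up _ _)   = # 1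
  kind (put _ _)       = # 2
  kind (meet _ _)      = # 3

  row : Cell → ℕ
  row (tree _ j _) = j
  row (put j _)    = j
  row (meet j _)   = j

  cell-≡ : ∀ c c′ → kind c ≡ kind c′ → row c ≡ row c′ → index c ≡ index c′ → c ≡ c′
  cell-≡ (tree down _ _) (tree down _ _) _ refl refl = refl
  cell-≡ (tree up _ _)   (tree up _ _)   _ refl refl = refl
  cell-≡ (put _ _)       (put _ _)       _ refl refl = refl
  cell-≡ (meet _ _)      (meet _ _)      _ refl refl = refl
  cell-≡ (put _ _)       (tree down _ _) ()
  cell-≡ (put _ _)       (tree up _ _)   ()
  cell-≡ (meet _ _)      (tree down _ _) ()
  cell-≡ (meet _ _)      (tree up _ _)   ()

  node-of : ∀ c → Valid c → Node (row c) (index c)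
  node-of (tree _ _ _) nd = nd
  node-of (put _ _)    nd = nd
  node-of (meet _ _)   nd = nd

  encode : ∀ c → Valid c → Fin cell-count
  encode c v = combine (combine (kind c) (fromℕ< (s≤s (Node.j≤W (node-of c v))))) (fromℕ< (Node.k< (node-of c v)))

  encode-injective : ∀ c c′ v v′ → encode c v ≡ encode c′ v′ → c ≡ c′
  encode-injective c c′ v v′ eq =
    let eq₁ , eq₂ = combine-injective _ _ _ _ eq
        eq₃ , eq₄ = combine-injective (kind c) _ (kind c′) _ eq₁
    in cell-≡ c c′ eq₃ (fromℕ<-injective _ _ _ _ eq₄) (fromℕ<-injective _ _ _ _ eq₂)

  -- Pigeonhole: kind, row and node determine a cell, so the positions of a duplicate-free list
  -- inject into the codes.
  length≤cell-count : ∀ {cs} → Unique cs → (∀ {c} → c ∈ cs → Valid c) → length cs ≤ cell-count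
  length≤cell-count {cs} u valid = injective⇒≤ {f = λ i → encode (List.lookup cs i) (valid (∈-lookup i))}
    λ {i} {j} eq → lookup-injective u (encode-injective _ _ (valid (∈-lookup i)) (valid (∈-lookup j)) eq)

  -- Start-up, reachable states and their bounds

  flagAdr-zero : ∀ j h → m₀ (flagAdr j h) ≡ + 0
  flagAdr-zero j h = m₀-zero (≤-trans (+-monoˡ-≤ (n + n) 2≤n+n) (R≤adr j _))

  -- Row `W` has no claiming leaf; the boot thread claims it by running into the claim code, so its
  -- flag is set while `D` is still empty.
  initial : Inv [] (tree down W 1 ∷ []) (m₀ [ flagAdr W 0 ↦ + 1 ])
  initial = record
    { unique   = [] ∷ []
    ; sound    = λ { (here refl) → inj₁ refl }
    ; complete = λ { (inj₁ refl) → here refl }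
    ; valid    = λ { (here refl) → node ≤-refl ≤-refl 2≤n+n }
    ; mem      = record
      { inputs  = inputs-write {m₀} _ (inj₁ (R≤adr W _)) (λ n≤k k< → m₀-value n≤k k< , m₀-weight n≤k k<)
      ; claimed = claimed
      ; met     = λ {j} {h} _ 1≤h h<n → inj₂
          ( trans (write-other m₀ _ λ eq → <⇒≢ 1≤h (sym (proj₂ (flagAdr-injective {j} {h} {W} {0} h<n n≥1 eq)))) (flagAdr-zero j h)
          , λ ())
      ; stored  = λ _ ()
      ; output  = λ ()
      }
    }
    where
    claimed : ∀ {j} → j ≤ W → Flag ((m₀ [ flagAdr W 0 ↦ + 1 ]) (flagAdr j 0)) (Born [] (tree down j 1))
    claimed {j} _ with j ≟ W
    ... | yes refl = inj₁ (write-same m₀ (flagAdr W 0) _ , inj₁ refl)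
    ... | no  j≢W = inj₂
      ( trans (write-other m₀ _ λ eq → j≢W (proj₁ (flagAdr-injective {j} {0} {W} n≥1 n≥1 eq))) (flagAdr-zero j 0)
      , λ { (inj₁ refl) → j≢W refl })

  Booted : Local 11 → Set
  Booted l = l ≡ (regs 0 W 0 (+ 0) (+ flagAdr W 0) (+ 0) , 10)

  first-claim : perform m₀ (regs 0 W 0 (+ 0) (+ flagAdr W 0) (+ 0) , 10) ≡
                next (m₀ [ flagAdr W 0 ↦ + 1 ]) (regs 0 W 0 (+ 0) (+ 0) (+ 0) , 11)
  first-claim = set-register (m₀ [ flagAdr W 0 ↦ + 1 ]) (regs 0 W 0 (+ 0) (+ flagAdr W 0) (+ 0) , 10)
    rT (+ 0) (flagAdr-zero W 0) z≤n

  boot : Reach (_≡ m₀) Booted 10 (replicate 11 (+ 0) , 0)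
  boot =
    load▸ refl refl (λ { m refl → m₀-n }) (≤-trans n≤R R≤B)
    (const▸ refl 1≤B
    (load▸ refl refl (λ { m refl → m₀-W }) W≤B
    (add▸ refl refl (≤-trans (m≤m+n (n + n) (n + n)) R≤B)
    (add▸ refl refl R≤B
    (add▸ refl (cong +_ (+-identityʳ W)) W≤B
    (claim-entry ≤-refl
    (here refl)))))))

  -- 32 pays for the 11 steps of the boot code and for the first cell.
  work span : ℕ
  work = 32 + K * cell-count
  span = 32 + K * height (tree down W 1)

  -- During the boot the root is the only thread and has written nothing, so the memory is `m₀`.
  -- Afterwards the steps made and the potential are paid for by 32 and by `K` for every cell ever
  -- started.
  data Reachable (p : ℕ) : State 11 → Set where
    booting : ∀ {r l} → Reach (_≡ m₀) Booted r l → p + r ≤ 10 → Reachable p (m₀ , running p l)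
    working : ∀ {D m T} (x : Forest span T) → Inv D (cells x) m →
              p + potential x ≤ 32 + K * length (D ++ cells x) → Reachable p (m , T)

  module _ {D cs : List Cell} {m : Memory} (inv : Inv D cs m) where
    open Inv inv

    ready-cells : ∀ {c} → c ∈ cs → Ready (sound ∘ ∈-++⁺ˡ) (valid ∘ ∈-++⁺ˡ) mem c
    ready-cells p = ready-cell (unique-disjoint D unique p) (sound (∈-++⁺ʳ D p)) (valid (∈-++⁺ʳ D p))

  reachable-step : ∀ {p σ σ′} → Reachable p σ → σ ⟶ σ′ → Reachable (suc p) σ′
  reachable-step {p} (booting (there f e) p≤) (step eq) with refl ← trans (sym (f m₀ refl)) eq =
    booting e (subst (_≤ 10) (+-suc p _) p≤)
  reachable-step (booting (there f e) p≤) (forking eq) with () ← trans (sym (f m₀ refl)) eq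
  reachable-step (booting (there f e) p≤) (halting eq) with () ← trans (sym (f m₀ refl)) eq
  reachable-step {p} (booting (here refl) p≤) (step eq)
    with refl ← trans (sym first-claim) eq =
    working
      (live (tree down W 1)
        (skip-if▸ refl (ℤ.+<+ (s≤s z≤n))
        (const▸ refl 1≤B
        (tree-entry down {x = + 0} {u = + 0} 1 (node ≤-refl ≤-refl 2≤n+n) (λ ()))))
        (begin
          suc p + (21 + K * h)     ≡⟨ +-assoc (suc p) 21 (K * h) ⟨
          suc p + 21 + K * h       ≤⟨ +-monoˡ-≤ (K * h) (+-monoˡ-≤ 21 p<11) ⟩
          32 + K * h               ∎))
      initial
      (≤-trans (+-monoˡ-≤ 21 p<11) (m≤m+n 32 _))
    where
    open ≤-Reasoning
    h = height (tree down W 1)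
    p<11 : suc p ≤ 11
    p<11 = s≤s (m+n≤o⇒m≤o p p≤)
  reachable-step (booting (here refl) p≤) (forking eq)
    with () ← trans (sym first-claim) eq
  reachable-step (booting (here refl) p≤) (halting eq)
    with () ← trans (sym first-claim) eq
  reachable-step {p} (working {D} {m} x inv p≤) s
    with advance (Inv.sound inv ∘ ∈-++⁺ˡ) (Inv.valid inv ∘ ∈-++⁺ˡ) (Inv.mem inv) x (ready-cells inv) s
  ... | silent x′ refl c≡ p< = working x′ (subst (λ cs → Inv D cs m) (sym c≡) inv)
      (≤-trans (≤-trans (≤-reflexive (sym (+-suc p _))) (+-monoʳ-≤ p p<))
               (subst (λ cs → p + potential x ≤ 32 + K * length (D ++ cs)) (sym c≡) p≤))
  ... | fired {c} {new} x′ c∈ sp perm mem′ p< = working x′ (fire inv c∈ sp perm mem′) (begin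
      suc p + potential x′                                ≡⟨ +-suc p _ ⟨
      p + suc (potential x′)                              ≤⟨ +-monoʳ-≤ p p< ⟩
      p + (potential x + K * length new)                  ≡⟨ +-assoc p _ _ ⟨
      p + potential x + K * length new                    ≤⟨ +-monoˡ-≤ (K * length new) p≤ ⟩
      32 + K * length (D ++ cells x) + K * length new     ≡⟨ +-assoc 32 (K * length (D ++ cells x)) (K * length new) ⟩
      32 + (K * length (D ++ cells x) + K * length new)   ≡⟨ cong (λ x → 32 + x) (*-distribˡ-+ K (length (D ++ cells x)) (length new)) ⟨
      32 + K * (length (D ++ cells x) + length new)       ≡⟨ cong (λ x → 32 + K * x) lengths ⟩
      32 + K * length ((c ∷ D) ++ cells x′)               ∎)
    where
    open ≤-Reasoning
    lengths : length (D ++ cells x) + length new ≡ length ((c ∷ D) ++ cells x′)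
    lengths = trans (+-comm _ (length new)) (trans (sym (length-++ new)) (sym (↭-length (regroup D {new = new} perm))))

  reachable-steps : ∀ {p t σ σ′} → Reachable p σ → σ ⟶[ t ] σ′ → Reachable (p + t) σ′
  reachable-steps {p} {σ = σ} i stop = subst (λ p → Reachable p σ) (sym (+-identityʳ p)) i
  reachable-steps {p} {σ′ = σ′} i (_◅_ {t = t} s ss) =
    subst (λ p → Reachable p σ′) (sym (+-suc p t)) (reachable-steps (reachable-step i s) ss)

  reachable : ∀ {t σ} → start m₀ ⟶[ t ] σ → Reachable t σ
  reachable = reachable-steps (booting boot ≤-refl)

  reachable-progress : ∀ {p m T} → Reachable p (m , T) → (∃[ s ] T ≡ finished s) ⊎ (∃[ σ ] (m , T) ⟶ σ)
  reachable-progress (booting (there f e) _) = inj₂ (_ , step (f m₀ refl))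
  reachable-progress (booting (here refl) _) = inj₂ (_ , step first-claim)
  reachable-progress (working x inv _) = can-step _ _ (Inv.mem inv) x (ready-cells inv)

  reachable-work : ∀ {p σ} → Reachable p σ → p ≤ work
  reachable-work {p} (booting _ p≤) = ≤-trans (m+n≤o⇒m≤o p p≤) (m≤m+n 10 _)
  reachable-work {p} (working x inv p≤) = ≤-trans (m+n≤o⇒m≤o p p≤)
    (+-monoʳ-≤ 32 (*-monoʳ-≤ K (length≤cell-count (Inv.unique inv) (Inv.valid inv))))

  -- A finished root thread leaves no live cell, so by completeness every born cell has been
  -- performed, and `root-done` applies to row `W`.
  reachable-correct : ∀ {p m s} → Reachable p (m , finished s) → s ≤ span × m 0 ≡ val W 1
  reachable-correct (working {D} (finished s≤) inv _) = s≤ , Mem.output mem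
    (root-done (λ b → none (complete b)) (λ p → valid (∈-++⁺ˡ p)) W (none (complete (inj₁ refl))))
    where
    open Inv inv
    none : ∀ {c} → c ∈ D ++ [] → c ∈ D
    none p with ∈-++⁻ D p
    ... | inj₁ q = q

  computes : Computes B program m₀ (λ m → m 0 ≡ val W 1) work span
  computes = record
    { work-bound = λ ss → reachable-work (reachable ss)
    ; progress   = λ ss → reachable-progress (reachable ss)
    ; span-bound = λ ss → proj₁ (reachable-correct (reachable ss))
    ; correct    = λ ss → proj₂ (reachable-correct (reachable ss))
    }

-- Input layout, word length and instantiation

fromList-++ˡ : ∀ {n} (f : Vector ℤ n) ys i → fromList (toList f ++ ys) (toℕ i) ≡ f i
fromList-++ˡ f ys zero    = refl
fromList-++ˡ f ys (suc i) = fromList-++ˡ (f ∘ suc) ys i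

fromList-++ʳ : ∀ {n} (f : Vector ℤ n) ys a → fromList (toList f ++ ys) (n + a) ≡ fromList ys a
fromList-++ʳ {zero}  f ys a = refl
fromList-++ʳ {suc n} f ys a = fromList-++ʳ (f ∘ suc) ys a

fromList-toList : ∀ {m} (f : Vector ℤ m) i → fromList (toList f) (toℕ i) ≡ f i
fromList-toList f zero    = refl
fromList-toList f (suc i) = fromList-toList (f ∘ suc) i

fromList-beyond : ∀ {n} (f : Vector ℤ n) {a} → n ≤ a → fromList (toList f) a ≡ + 0
fromList-beyond {zero}  f _         = refl
fromList-beyond {suc n} f (s≤s n≤a) = fromList-beyond (f ∘ suc) n≤a

minimum≤ : ∀ {m} (f : Vector ℕ (suc m)) i → minimum f ≤ f i
minimum≤ f zero    = start≤ (f ∘ suc)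
  where
  start≤ : ∀ {z k} (g : Vector ℕ k) → foldr _⊓_ z g ≤ z
  start≤ {k = zero}  g = ≤-refl
  start≤ {k = suc k} g = ≤-trans (m⊓n≤n (g zero) _) (start≤ (g ∘ suc))
minimum≤ f (suc i) = entry≤ (f ∘ suc) i
  where
  entry≤ : ∀ {z k} (g : Vector ℕ k) i → foldr _⊓_ z g ≤ g i
  entry≤ g zero    = m⊓n≤m (g zero) _
  entry≤ g (suc i) = ≤-trans (m⊓n≤n (g zero) _) (entry≤ (g ∘ suc) i)

module WordLength {n W w V s : ℕ} (s≡ : s ≡ 2 + n + W + w + V) where

  private
    2≤s : 2 ≤ s
    2≤s = ≤-trans (≤-trans (m≤m+n 2 n) (≤-trans (m≤m+n _ W) (≤-trans (m≤m+n _ w) (m≤m+n _ V)))) (≤-reflexive (sym s≡))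

    instance
      s-nonZero : NonZero s
      s-nonZero = >-nonZero (≤-trans (s≤s z≤n) 2≤s)

    s*s≤ : s * s ≤ s ^ 4
    s*s≤ = ≤-trans (≤-reflexive (cong (s *_) (sym (*-identityʳ s)))) (^-monoʳ-≤ s {2} {4} (≤ᵇ⇒≤ 2 4 tt))

    s≤s*s : s ≤ s * s
    s≤s*s = m≤m*n s s

    drop : ∀ {x y} → x + y ≡ s → x ≤ s
    drop {x} refl = m≤m+n x _

  W+w≤ : W + w ≤ s ^ 4
  W+w≤ = ≤-trans (drop {W + w} {2 + n + V} (trans (shuffle n W w V) (sym s≡))) (≤-trans s≤s*s s*s≤)
    where
    shuffle : ∀ n W w V → W + w + (2 + n + V) ≡ 2 + n + W + w + V
    shuffle = solve-∀

  V≤s : V ≤ s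
  V≤s = ≤-trans (m≤n+m V _) (≤-reflexive (sym s≡))

  suc-W≤s : suc W ≤ s
  suc-W≤s = drop {suc W} {1 + n + w + V} (trans (shuffle n W w V) (sym s≡))
    where
    shuffle : ∀ n W w V → suc W + (1 + n + w + V) ≡ 2 + n + W + w + V
    shuffle = solve-∀

  V≤ : V ≤ s ^ 4
  V≤ = ≤-trans V≤s (≤-trans s≤s*s s*s≤)

  W*V≤ : suc W * V ≤ s ^ 4
  W*V≤ = ≤-trans (*-mono-≤ suc-W≤s V≤s) s*s≤

  -- Each of the factors `2 + W`, `n`, `2` and `2` is at most `s`. This is the origin of the
  -- exponent 4.
  area≤ : (2 + W) * ((n + n) + (n + n)) ≤ s ^ 4
  area≤ = begin
    (2 + W) * ((n + n) + (n + n))   ≡⟨ cong ((2 + W) *_) (four n) ⟩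
    (2 + W) * (n * (2 * (2 * 1)))   ≤⟨ *-mono-≤ 2+W≤s (*-mono-≤ n≤s (*-mono-≤ 2≤s (*-monoˡ-≤ 1 2≤s))) ⟩
    s ^ 4                           ∎
    where
    open ≤-Reasoning
    four : ∀ n → (n + n) + (n + n) ≡ n * (2 * (2 * 1))
    four = solve-∀
    shuffle : ∀ n W w V → 2 + W + (n + w + V) ≡ 2 + n + W + w + V
    shuffle = solve-∀
    shuffle′ : ∀ n W w V → n + (2 + W + w + V) ≡ 2 + n + W + w + V
    shuffle′ = solve-∀
    2+W≤s : 2 + W ≤ s
    2+W≤s = drop {2 + W} {n + w + V} (trans (shuffle n W w V) (sym s≡))
    n≤s : n ≤ s
    n≤s = drop {n} (trans (shuffle′ n W w V) (sym s≡))

module _ (knapsack : Knapsack) where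
  open Knapsack knapsack hiding (rank)
  open KnapsackValue knapsack
  open WordLength {n} {W} {∑ℕ weight} {V} {size} refl

  item-toℕ : ∀ {k} → n ≤ k → k < n + n → k ≡ n + toℕ (item k)
  item-toℕ {k} n≤k k< = begin
    k                     ≡⟨ m+[n∸m]≡n n≤k ⟨
    n + (k ∸ n)           ≡⟨ cong (λ x → n + x) (m<n⇒m%n≡m (m<n+o⇒m∸n<o k n k<)) ⟨
    n + (k ∸ n) % n       ≡⟨ cong (λ x → n + x) ([m+n]%n≡m%n (k ∸ n) n) ⟨
    n + (k ∸ n + n) % n   ≡⟨ cong (λ x → n + x % n) (m∸n+n≡m n≤k) ⟩
    n + k % n             ≡⟨ cong (λ x → n + x) (toℕ-fromℕ< _) ⟨
    n + toℕ (item k)      ∎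
    where open ≡-Reasoning

  weights values : Vector ℤ n
  weights i = + weight i
  values    = value

  input-weight : ∀ {k} → n ≤ k → k < n + n → input knapsack (2 + k ∸ n) ≡ + itemWeight k
  input-weight {k} n≤k k< = begin
    input knapsack (2 + k ∸ n)                             ≡⟨ cong (input knapsack) (+-∸-assoc 2 n≤k) ⟩
    fromList (toList weights ++ toList values) (k ∸ n)      ≡⟨ cong (λ x → fromList (toList weights ++ toList values) (x ∸ n)) (item-toℕ n≤k k<) ⟩
    fromList (toList weights ++ toList values) (n + toℕ (item k) ∸ n) ≡⟨ cong (fromList (toList weights ++ toList values)) (m+n∸m≡n n (toℕ (item k))) ⟩
    fromList (toList weights ++ toList values) (toℕ (item k)) ≡⟨ fromList-++ˡ weights (toList values) (item k) ⟩
    + itemWeight k                                          ∎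
    where open ≡-Reasoning

  input-value : ∀ {k} → n ≤ k → k < n + n → input knapsack (2 + k) ≡ itemValue k
  input-value {k} n≤k k< = begin
    input knapsack (2 + k)                                        ≡⟨ cong (fromList (toList weights ++ toList values)) (item-toℕ n≤k k<) ⟩
    fromList (toList weights ++ toList values) (n + toℕ (item k)) ≡⟨ fromList-++ʳ weights (toList values) (toℕ (item k)) ⟩
    fromList (toList values) (toℕ (item k))                       ≡⟨ fromList-toList values (item k) ⟩
    itemValue k                                                   ∎
    where open ≡-Reasoning

  input-zero : ∀ {a} → 2 + (n + n) ≤ a → input knapsack a ≡ + 0
  input-zero {suc (suc a′)} (s≤s (s≤s n+n≤a′)) = begin
    fromList (toList weights ++ toList values) a′              ≡⟨ cong (fromList (toList weights ++ toList values)) (m+[n∸m]≡n (m+n≤o⇒m≤o n n+n≤a′)) ⟨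
    fromList (toList weights ++ toList values) (n + (a′ ∸ n))  ≡⟨ fromList-++ʳ weights (toList values) (a′ ∸ n) ⟩
    fromList (toList values) (a′ ∸ n)                          ≡⟨ fromList-beyond values (m+n≤o⇒m≤o∸n n n+n≤a′) ⟩
    + 0                                                        ∎
    where open ≡-Reasoning

  setup : Setup
  setup = record
    { n = n
    ; W = W
    ; B = size ^ 4
    ; ω = w*
    ; wt = itemWeight
    ; vl = itemValue
    ; val = val
    ; m₀ = input knapsack
    ; n≥1 = s≤s z≤n
    ; ω≥1 = w*-nonZero
    ; ω≤wt = λ k → minimum≤ weight (item k)
    ; area≤B = area≤
    ; wt≤B = λ k → ≤-trans (+-monoʳ-≤ W (∑-bounds weight (item k))) W+w≤
    ; vl≤B = λ k → ≤-trans (∣value∣≤V (item k)) V≤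
    ; val≤B = λ {j} j≤W 1≤k k< → ≤-trans (∣val∣≤ j 1≤k k<) (≤-trans (*-monoˡ-≤ V (m≤n⇒m≤1+n j≤W)) W*V≤)
    -- One item on top of `j * V` gives `suc j * V`, which `suc W * V` bounds.
    ; sum≤B = λ {j} k j≤W → ≤-trans (ℤ.∣i+j∣≤∣i∣+∣j∣ (val j 1) (itemValue k))
        (≤-trans (+-mono-≤ (∣val∣≤ j ≤-refl (+-mono-≤ (s≤s z≤n) (s≤s z≤n))) (∣value∣≤V (item k)))
        (≤-trans (≤-reflexive (+-comm (j * V) V)) (≤-trans (*-monoˡ-≤ V (s≤s j≤W)) W*V≤)))
    ; val-node = val-node
    ; val-skip = val-skip
    ; val-take = λ {j} → val-take {j}
    ; m₀-n = refl
    ; m₀-W = refl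
    ; m₀-weight = input-weight
    ; m₀-value = input-value
    ; m₀-zero = input-zero
    }

-- The constants of the work and span bounds

work-arithmetic : ∀ K n W → 1 ≤ n → 32 + K * (4 * suc W * (n + n)) ≤ (32 + 23 * K) * (n * (W ⊔ 1))
work-arithmetic K n W 1≤n = begin
  32 + K * (4 * suc W * (n + n))
    ≤⟨ +-mono-≤ (*-monoʳ-≤ 32 (*-mono-≤ 1≤n 1≤X)) (*-monoʳ-≤ K (*-monoˡ-≤ (n + n) (*-monoʳ-≤ 4 (+-mono-≤ 1≤X (m≤m⊔n W 1))))) ⟩
  32 * (n * X) + K * (4 * (X + X) * (n + n))
    -- The work takes only `16 * K`; the rest raises it to the `23 * K` of the span, as both bounds
    -- share one constant.
    ≤⟨ m≤m+n _ (7 * K * (n * X)) ⟩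
  32 * (n * X) + K * (4 * (X + X) * (n + n)) + 7 * K * (n * X)
    ≡⟨ collect K n X ⟩
  (32 + 23 * K) * (n * X) ∎
  where
  open ≤-Reasoning
  X = W ⊔ 1
  1≤X = m≤n⊔m W 1
  collect : ∀ K n X → 32 * (n * X) + K * (4 * (X + X) * (n + n)) + 7 * K * (n * X) ≡ (32 + 23 * K) * (n * X)
  collect = solve-∀

-- With `y = l ⊔ 1`, the bounds `suc L ≤ 3y`, `L ≤ 2y` and twice `lap ≤ 9y` add up to the
-- coefficient 23.
span-arithmetic : ∀ K r l → let L = suc l ; lap = 3 + (L + L + L) in
  32 + K * (r * suc L + L + (r * lap + lap)) ≤ (32 + 23 * K) * ((r ⊔ 1) * (l ⊔ 1))
span-arithmetic K r l = begin
  32 + K * (r * suc L + L + (r * lap + lap))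
    ≤⟨ +-mono-≤ (*-monoʳ-≤ 32 (*-mono-≤ 1≤x 1≤y)) (*-monoʳ-≤ K
         (+-mono-≤ (+-mono-≤ (*-mono-≤ r≤x (+-mono-≤ 1≤y L≤)) (≤-trans L≤ (m≤n*m (y + y) x {{>-nonZero 1≤x}})))
                   (+-mono-≤ (*-mono-≤ r≤x lap≤) (≤-trans lap≤ (m≤n*m _ x {{>-nonZero 1≤x}}))))) ⟩
  32 * (x * y) + K * (x * (y + (y + y)) + x * (y + y) + (x * (3 * y + (y + y + (y + y) + (y + y))) + x * (3 * y + (y + y + (y + y) + (y + y)))))
    ≡⟨ collect K x y ⟩
  (32 + 23 * K) * (x * y) ∎
  where
  open ≤-Reasoning
  L = suc l
  lap = 3 + (L + L + L)
  x = r ⊔ 1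
  y = l ⊔ 1
  r≤x = m≤m⊔n r 1
  1≤x = m≤n⊔m r 1
  1≤y = m≤n⊔m l 1
  L≤ : L ≤ y + y
  L≤ = +-mono-≤ 1≤y (m≤m⊔n l 1)
  lap≤ : lap ≤ 3 * y + (y + y + (y + y) + (y + y))
  lap≤ = +-mono-≤ (*-monoʳ-≤ 3 1≤y) (+-mono-≤ (+-mono-≤ L≤ L≤) L≤)
  collect : ∀ K x y → 32 * (x * y) + K * (x * (y + (y + y)) + x * (y + y) + (x * (3 * y + (y + y + (y + y) + (y + y))) + x * (3 * y + (y + y + (y + y) + (y + y))))) ≡ (32 + 23 * K) * (x * y)
  collect = solve-∀

relax : ∀ {B P m₀ Post Post′ work work′ span span′} → (∀ m → Post m → Post′ m) → work ≤ work′ → span ≤ span′ →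
        Computes B P m₀ Post work span → Computes B P m₀ Post′ work′ span′
relax post work≤ span≤ c = record
  { work-bound = λ ss → ≤-trans (work-bound ss) work≤
  ; progress   = progress
  ; span-bound = λ ss → ≤-trans (span-bound ss) span≤
  ; correct    = λ ss → post _ (correct ss)
  }
  where open Computes c

-- The factors `⊔ 1` keep the bounds positive for `W = 0`, rank `0` or a single item, where the
-- plain products vanish although some instructions always run.
theorem4p3 : ∃[ P ] ∃[ c ] ∃[ d ] ((K : Knapsack) → let open Knapsack K in
    Computes (size ^ d) P (input K) (OutputsOptimum K)
    (c * (n * (W ⊔ 1)))
    (c * ((rank ⊔ 1) * (⌊log₂ n ⌋ ⊔ 1))))
theorem4p3 = program , 32 + 23 * K , 4 , λ knapsack →
  let open Knapsack knapsack in
  relax (λ m m0≡ → subst IsOptimum (sym m0≡) (KnapsackValue.val-optimum knapsack))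
        (work-arithmetic K n W (s≤s z≤n))
        (span-arithmetic K rank ⌊log₂ n ⌋)
        (Machine.computes (setup knapsack))
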